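{- Let $q=2^{s_0}$ be a sufficiently large power of two and $N=q^2$. Then every Sudoku solution $F\colon\{1,\dots,N\}\times\mathbb{Z}\to\Sigma$ with good columns is non-periodic.
   Context: Let $q=2^{s_0}$, $\Sigma=(\mathbb{Z}/q\mathbb{Z})\setminus\{0\}$, $N=q^2$, and $\mathbb{B}=\{1,\dots,N\}\times\mathbb{Z}$. Define $f_q\colon\mathbb{Z}\to\Sigma$ by $f_q(q^k m)=m \bmod q$ for $k\ge0$ and $m\in\mathbb{Z}$ not divisible by $q$, and $f_q(0)=1$ (the last nonzero base-$q$ digit). Let $\mathcal{S}[N]$ be the set of functions $g\colon\{1,\dots,N\}\to\Sigma$ of the form $g(n)=c f_q(an+b)$ for all $n$, for some integers $a,b,c$ with $c$ odd. A Sudoku solution is a function $F\colon\mathbb{B}\to\Sigma$ such that for every $i,j\in\mathbb{Z}$ the function $n\mapsto F(n,jn+i)$ lies in $\mathcal{S}[N]$. It has good columns if for every $n=1,\dots,N$ there is a permutation $\sigma_n$ of $\mathbb{Z}/q\mathbb{Z}$ with $F(n,m)=\sigma_n(m\bmod q)$ whenever $\sigma_n(m\bmod q)\neq0$. It is periodic if every column $m\mapsto F(n,m)$ ($n=1,\dots,N$) is periodic, and non-periodic otherwise. -}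

module Defs where

open import Data.Nat as ℕ using (ℕ; zero; suc; _^_; NonZero)
open import Data.Nat.Properties using (m^n≢0)
open import Data.Integer as ℤ using (ℤ; +_; -[1+_]; _%ℕ_)
open import Data.Integer.DivMod using (n%ℕd<d)
open import Data.Fin as Fin using (Fin)
open import Data.Fin.Permutation using (Permutation′; _⟨$⟩ʳ_)
open import Data.Product using (Σ; ∃; _×_; _,_)
open import Relation.Binary.PropositionalEquality using (_≡_; _≢_)
open import Relation.Nullary using (¬_)

qOf : ℕ → ℕ
qOf s₀ = 2 ^ s₀

NOf : ℕ → ℕ
NOf s₀ = qOf s₀ ℕ.* qOf s₀

qOf-nonZero : ∀ s₀ → NonZero (qOf s₀)
qOf-nonZero s₀ = m^n≢0 2 s₀

-- ℤ/qℤ is represented by Fin q (residues 0..q-1); Σ = its nonzero elements.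
-- reduction map ℤ → ℤ/qℤ
red : (q : ℕ) .{{_ : NonZero q}} → ℤ → Fin q
red q x = Fin.fromℕ< (n%ℕd<d x q)

_·[_]_ : ℤ → (q : ℕ) .{{_ : NonZero q}} → Fin q → Fin q
c ·[ q ] r = red q (c ℤ.* + Fin.toℕ r)

-- For n ≥ 1: (m mod q) where n = q^k m with q ∤ m  (m a natural number).
-- Computed by stripping trailing zero digits; 'fuel' bounds the number of
-- divisions (fuel = n suffices for q ≥ 2 and n ≥ 1).
lastDigitℕ : ℕ → (q : ℕ) .{{_ : NonZero q}} → ℕ → ℕ
lastDigitℕ zero    q n = n ℕ.% q
lastDigitℕ (suc f) q n with n ℕ.% q
... | zero  = lastDigitℕ f q (n ℕ./ q)
... | suc r = suc r

f : (q : ℕ) .{{_ : NonZero q}} → ℤ → Fin q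
f q (+ zero)    = red q (+ 1)
f q (+ suc n)   = red q (+ lastDigitℕ (suc n) q (suc n))
f q -[1+ n ]    = red q (ℤ.- (+ lastDigitℕ (suc n) q (suc n)))

OddInt : ℤ → Set
OddInt c = Σ ℤ λ k → c ≡ (+ 2) ℤ.* k ℤ.+ + 1

-- g ∈ 𝒮[N]  (g : {1..N} → Σ, given as a function on ℕ, only 1..N matters)
InS : (s₀ : ℕ) → (ℕ → Fin (qOf s₀)) → Set
InS s₀ g = Σ ℤ λ a → Σ ℤ λ b → Σ ℤ λ c → OddInt c ×
  (∀ (n : ℕ) → 1 ℕ.≤ n → n ℕ.≤ NOf s₀ →
     g n ≡ _·[_]_ c (qOf s₀) {{qOf-nonZero s₀}} (f (qOf s₀) {{qOf-nonZero s₀}} (a ℤ.* + n ℤ.+ b)))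

-- F : 𝔹 = {1..N} × ℤ → Σ  is given as a function ℕ → ℤ → Fin q; only rows
-- 1..N matter, and 'ValuesInΣ' records that values lie in Σ = (ℤ/qℤ)∖{0}.
Board : ℕ → Set
Board s₀ = ℕ → ℤ → Fin (qOf s₀)

ValuesInΣ : (s₀ : ℕ) → Board s₀ → Set
ValuesInΣ s₀ F = ∀ n m → 1 ℕ.≤ n → n ℕ.≤ NOf s₀ → F n m ≢ red (qOf s₀) {{qOf-nonZero s₀}} (+ 0)

SudokuSolution : (s₀ : ℕ) → Board s₀ → Set
SudokuSolution s₀ F = ValuesInΣ s₀ F ×
  (∀ (i j : ℤ) → InS s₀ (λ n → F n (j ℤ.* + n ℤ.+ i)))

GoodColumns : (s₀ : ℕ) → Board s₀ → Set
GoodColumns s₀ F = ∀ n → 1 ℕ.≤ n → n ℕ.≤ NOf s₀ →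
  Σ (Permutation′ (qOf s₀)) λ σ → ∀ (m : ℤ) →
    σ ⟨$⟩ʳ red (qOf s₀) {{qOf-nonZero s₀}} m ≢ red (qOf s₀) {{qOf-nonZero s₀}} (+ 0) → F n m ≡ σ ⟨$⟩ʳ red (qOf s₀) {{qOf-nonZero s₀}} m

PeriodicColumn : (s₀ : ℕ) → Board s₀ → ℕ → Set
PeriodicColumn s₀ F n = Σ ℕ λ p → 1 ℕ.≤ p × (∀ (m : ℤ) → F n (m ℤ.+ + p) ≡ F n m)

Periodic : (s₀ : ℕ) → Board s₀ → Set
Periodic s₀ F = ∀ n → 1 ℕ.≤ n → n ℕ.≤ NOf s₀ → PeriodicColumn s₀ F n

NonPeriodic : (s₀ : ℕ) → Board s₀ → Set
NonPeriodic s₀ F = ¬ Periodic s₀ F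

{-# OPTIONS --safe #-}
-- Modulo q, the values of a Sudoku solution along a line are an affine function h, except where
-- h vanishes; there the values at distance q are again affine, with the same slope as h.  Good
-- columns are permutations S n of ℤ/q off their zeros.  Comparing the lines through a point, one
-- finds first that a line through a nonzero entry rarely has h = 0 there, because the next digit
-- would determine its slope, and then that a line through a zero of S n has h = 0 there for all
-- but a bounded number of slopes.  Hence the zeros of the columns lie on a common line
-- m = s n + i, and the next digit along the lines through a zero shows that the Sudoku solution
-- (n , k) ↦ V n (s n + i + q k) has good columns as well.  The period p of a good column is
-- divisible by q, and the new solution has period p / q: infinite descent.
module Submission where

open import Defs
open import Data.Nat using (ℕ; _≤_)
open import Data.Product using (Σ)
open import Data.Nat as ℕ using (zero; suc)
import Data.Nat.Properties as ℕₚ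
import Data.Nat.Divisibility as ℕ∣
import Data.Nat.DivMod as ℕ/
open import Data.Nat.Induction using (<-rec)
open import Data.Integer as ℤ using (ℤ; +_; -[1+_]; _+_; _*_; _-_; -_; ∣_∣; 0ℤ; 1ℤ; _%ℕ_; _/ℕ_) renaming (suc to sucℤ)
import Data.Integer.Properties as ℤₚ
open import Data.Integer.DivMod using (a≡a%ℕn+[a/ℕn]*n; n%ℕd<d)
open import Data.Integer.Divisibility.Signed
  using (_∣_; divides; _∣?_; ∣m∣n⇒∣m+n; ∣m∣n⇒∣m-n; ∣n⇒∣m*n; ∣⇒∣ᵤ; ∣ᵤ⇒∣)
open import Data.Integer.Tactic.RingSolver using (solve; solve-∀)
open import Data.Fin as Fin using (Fin; toℕ)
import Data.Fin.Properties as Finₚ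
open import Data.Fin.Permutation using (_⟨$⟩ʳ_)
open import Data.List using ([]; _∷_)
open import Data.Vec as Vec using (Vec; _++_; lookup)
open import Data.Vec.Relation.Unary.All as All using (All)
open import Data.Vec.Relation.Unary.All.Properties using (++⁻)
open import Data.Vec.Relation.Unary.Any as Any using (Any)
open import Data.Vec.Relation.Unary.Any.Properties using (lookup-index)
open import Data.Product using (∃; _×_; _,_; proj₁; proj₂)
open import Data.Sum as Sum using (_⊎_; inj₁; inj₂)
open import Data.Empty using (⊥; ⊥-elim)
open import Function using (_∘_)
open import Function.Bundles using (Injection)
open import Function.Properties.Inverse using (↔⇒↣)
open import Relation.Nullary using (¬_; Dec; yes; no; contradiction)
open import Relation.Nullary.Decidable using (map′; ¬?; toSum; decidable-stable; True; toWitness; _×-dec_)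
open import Relation.Binary.PropositionalEquality
  using (_≡_; refl; sym; trans; cong; cong₂; subst; subst₂; module ≡-Reasoning)

-- An identity between entries on a line can fail only if some entry or some h vanishes or takes a
-- few special values. This excludes boundedly many slopes modulo q, so it is enough to count
-- excluded classes and let q exceed the total. Three obstacles shape the statements. Good columns
-- see rows only modulo q, whereas the next digit belongs to an integer row: where that digit must
-- be one fixed number, the line is pinned to a cell of column n + q, and it then meets column n in
-- a fixed residue class only. Next, 2 is not invertible modulo q: passing from j to 2j doubles the
-- number of excluded classes, and several identities concern 2 S instead of S; but 2w ≈ z + t still
-- determines t from z and w. Finally, where the next digit κ is 0 modulo q, the entry says nothing
-- about it. Approximate translations of the neighbouring column show that, for a given cell, this
-- happens for all generic slopes or for none.

module Congruence (q : ℕ) where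

  -- Congruence modulo q and exceptional residue classes

  infix 4 _≈_ _≉_ _≈?_

  -- The record keeps both sides recoverable by unification, which the bare divisibility of a - b
  -- would not.
  record _≈_ (a b : ℤ) : Set where
    constructor mod
    field difference : + q ∣ a - b
  open _≈_

  _≉_ : ℤ → ℤ → Set
  a ≉ b = ¬ a ≈ b

  _≈?_ : ∀ a b → Dec (a ≈ b)
  a ≈? b = map′ mod difference (+ q ∣? (a - b))

  -- A congruence is proved by a linear combination of known ones, formed with
  -- the operators _⊞_, _⊟_ and scale, and a ring identity between the differences.
  infixl 0 _via_
  infixl 6 _⊞_ _⊟_

  _via_ : ∀ {a b x y} → a ≈ b → x - y ≡ a - b → x ≈ y
  mod d via eq = mod (subst (+ q ∣_) (sym eq) d)

  multiple : ∀ k {x y} → x - y ≡ k * + q → x ≈ y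
  multiple k eq = mod (divides k eq)

  _⊞_ : ∀ {a b c d} → a ≈ b → c ≈ d → a + c ≈ b + d
  _⊞_ {a} {b} {c} {d} (mod p) (mod r) = mod (subst (+ q ∣_) (lemma a b c d) (∣m∣n⇒∣m+n p r))
    where
    lemma : ∀ a b c d → (a - b) + (c - d) ≡ (a + c) - (b + d)
    lemma = solve-∀

  _⊟_ : ∀ {a b c d} → a ≈ b → c ≈ d → a - c ≈ b - d
  _⊟_ {a} {b} {c} {d} (mod p) (mod r) = mod (subst (+ q ∣_) (lemma a b c d) (∣m∣n⇒∣m-n p r))
    where
    lemma : ∀ a b c d → (a - b) - (c - d) ≡ (a - c) - (b - d)
    lemma = solve-∀

  scale : ∀ k {a b} → a ≈ b → k * a ≈ k * b
  scale k {a} {b} (mod p) = mod (subst (+ q ∣_) (lemma k a b) (∣n⇒∣m*n k p))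
    where
    lemma : ∀ k a b → k * (a - b) ≡ k * a - k * b
    lemma = solve-∀

  ≈-reflexive : ∀ {a b} → a ≡ b → a ≈ b
  ≈-reflexive {a} refl = multiple 0ℤ (lemma a)
    where
    lemma : ∀ a → a - a ≡ 0ℤ
    lemma = solve-∀

  ≈-refl : ∀ {a} → a ≈ a
  ≈-refl = ≈-reflexive refl

  ≈-sym : ∀ {a b} → a ≈ b → b ≈ a
  ≈-sym {a} {b} p = ≈-refl {0ℤ} ⊟ p via lemma a b
    where
    lemma : ∀ a b → b - a ≡ (0ℤ - a) - (0ℤ - b)
    lemma = solve-∀

  ≈-trans : ∀ {a b c} → a ≈ b → b ≈ c → a ≈ c
  ≈-trans {a} {b} {c} p r = p ⊞ r via lemma a b c
    where
    lemma : ∀ a b c → a - c ≡ (a + b) - (b + c)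
    lemma = solve-∀

  residue-injective : ∀ (i j : Fin q) → + toℕ i ≈ + toℕ j → i ≡ j
  residue-injective i j (mod d) =
    Finₚ.toℕ-injective (ℤₚ.+-injective (ℤₚ.i-j≡0⇒i≡j (+ toℕ i) (+ toℕ j) (ℤₚ.∣i∣≡0⇒i≡0 (vanish _ bound (∣⇒∣ᵤ d)))))
    where
    bound : ∣ + toℕ i - + toℕ j ∣ ℕ.< q
    bound = subst (λ x → ∣ x ∣ ℕ.< q) (sym (ℤₚ.[+m]-[+n]≡m⊖n (toℕ i) (toℕ j)))
      (ℕₚ.≤-<-trans (ℤₚ.∣m⊝n∣≤m⊔n (toℕ i) (toℕ j)) (ℕₚ.⊔-pres-<m (Finₚ.toℕ<n i) (Finₚ.toℕ<n j)))
    vanish : ∀ m → m ℕ.< q → q ℕ∣.∣ m → m ≡ 0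
    vanish zero    _   _ = refl
    vanish (suc m) m<q r = contradiction r (ℕ∣.>⇒∤ m<q)

  red-≈ : .{{_ : ℕ.NonZero q}} → ∀ x → + toℕ (red q x) ≈ x
  red-≈ x = ≈-sym (multiple (x /ℕ q) (begin
    x - + toℕ (red q x)                           ≡⟨ cong (λ r → x - + r) (Finₚ.toℕ-fromℕ< (n%ℕd<d x q)) ⟩
    x - + (x %ℕ q)                                ≡⟨ cong (_- + (x %ℕ q)) (a≡a%ℕn+[a/ℕn]*n x q) ⟩
    + (x %ℕ q) + (x /ℕ q) * + q - + (x %ℕ q)      ≡⟨ lemma (+ (x %ℕ q)) (x /ℕ q * + q) ⟩
    (x /ℕ q) * + q                                ∎))
    where
    open ≡-Reasoning
    lemma : ∀ r m → r + m - r ≡ m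
    lemma = solve-∀

  -- The count sits in the type: it adds up under `_⊗_`, and the total is compared with q by
  -- computation. `P` may speak of entries at integer rows, which are not periodic modulo q.
  record Generic (n : ℕ) (P : ℤ → Set) : Set where
    constructor outside
    field
      classes : Vec ℤ n
      holds   : ∀ j → All (j ≉_) classes → P j

  infixr 5 _⊗_

  _⊗_ : ∀ {m n P Q} → Generic m P → Generic n Q → Generic (m ℕ.+ n) (λ j → P j × Q j)
  outside xs p ⊗ outside ys r = outside (xs ++ ys) λ j a → p j (proj₁ (++⁻ xs a)) , r j (proj₂ (++⁻ xs a))

  weaken : ∀ {n P Q} → (∀ j → P j → Q j) → Generic n P → Generic n Q
  weaken h (outside xs p) = outside xs λ j a → h j (p j a)

  pull : ∀ {n P} (f g : ℤ → ℤ) → (∀ j x → f j ≈ x → j ≈ g x) → Generic n P → Generic n (P ∘ f)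
  pull {P = P} f g h (outside xs p) = outside (Vec.map g xs) λ j a → p (f j) (back j xs a)
    where
    back : ∀ {n} j (xs : Vec ℤ n) → All (j ≉_) (Vec.map g xs) → All (f j ≉_) xs
    back j Vec.[]       All.[]        = All.[]
    back j (x Vec.∷ xs) (a All.∷ as) = (a ∘ h j x) All.∷ back j xs as

  shift : ∀ {n P} c → Generic n P → Generic n (λ j → P (c + j))
  shift c = pull (_+_ c) (_- c) λ j x e → e via lemma c j x
    where
    lemma : ∀ c j x → j - (x - c) ≡ (c + j) - x
    lemma = solve-∀

  reflect : ∀ {n P} c → Generic n P → Generic n (λ j → P (c - j))
  reflect c = pull (λ j → c - j) (λ x → c - x) λ j x e → ≈-refl {0ℤ} ⊟ e via lemma c j x
    where
    lemma : ∀ c j x → j - (c - x) ≡ (0ℤ - (c - j)) - (0ℤ - x)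
    lemma = solve-∀

  avoid : ∀ c → Generic 1 (_≉ c)
  avoid c = outside (c Vec.∷ Vec.[]) λ { j (a All.∷ All.[]) → a }

  -- Were each of the q residues congruent to one of the n < q listed classes, two of them would be
  -- congruent to the same one.
  generic-exists : ∀ {n P} → n ℕ.< q → Generic n P → ∃ P
  generic-exists {n} n<q (outside xs p) with Finₚ.any? (λ i → All.all? (λ x → ¬? (+ toℕ i ≈? x)) xs)
  ... | yes (i , a) = + toℕ i , p _ a
  ... | no  none    = ⊥-elim (collide (Finₚ.pigeonhole n<q (Any.index ∘ hit)))
    where
    hit : ∀ (i : Fin q) → Any (+ toℕ i ≈_) xs
    hit i with All.decide (λ x → Sum.swap (toSum (+ toℕ i ≈? x))) xs
    ... | inj₁ a = contradiction (i , a) none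
    ... | inj₂ h = h
    collide : (∃ λ i → ∃ λ j → i Fin.< j × Any.index (hit i) ≡ Any.index (hit j)) → ⊥
    collide (i , j , i<j , e) = Finₚ.<⇒≢ i<j (residue-injective i j (≈-trans (lookup-index (hit i))
      (subst (λ k → lookup xs k ≈ + toℕ j) (sym e) (≈-sym (lookup-index (hit j))))))

  -- Pigeonhole on the q + 1 values c, g 0, ..., g (q - 1): two are congruent, and injectivity
  -- forces one of them to be c.
  injective⇒surjective : .{{_ : ℕ.NonZero q}} → ∀ (g : ℤ → ℤ) → (∀ {m m′} → g m ≈ g m′ → m ≈ m′) →
    ∀ c → ∃ λ m → g m ≈ c
  injective⇒surjective g inj c = find (Finₚ.pigeonhole (ℕₚ.n<1+n q) (red q ∘ value))
    where
    value : Fin (suc q) → ℤ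
    value Fin.zero    = c
    value (Fin.suc i) = g (+ toℕ i)
    red-injective : ∀ {x y} → red q x ≡ red q y → x ≈ y
    red-injective {x} {y} e = ≈-trans (≈-sym (red-≈ x)) (subst (λ r → + toℕ r ≈ y) (sym e) (red-≈ y))
    find : (∃ λ i → ∃ λ j → i Fin.< j × red q (value i) ≡ red q (value j)) → ∃ λ m → g m ≈ c
    find (Fin.zero  , Fin.suc j , _   , e) = + toℕ j , ≈-sym (red-injective e)
    find (Fin.suc i , Fin.suc j , i<j , e) =
      contradiction (cong Fin.suc (residue-injective i j (inj (red-injective e)))) (Finₚ.<⇒≢ i<j)

-- Doubling modulo q, good columns and lines

module Boards (q half N : ℕ) (q-even : + q ≡ + half + + half) where
  open Congruence q

  -- From 2 (x - y) = k q follows x - y = k half, and the parity of k decides between the cases.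
  halve : ∀ {x y} → x + x ≈ y + y → x ≈ y ⊎ x ≈ y + + half
  halve {x} {y} (mod (divides k eq)) = parity (k %ℕ 2) (n%ℕd<d k 2) (a≡a%ℕn+[a/ℕn]*n k 2)
    where
    difference≡ : ∀ c → k ≡ c → x - y ≡ c * + half
    difference≡ c e = ℤₚ.*-cancelʳ-≡ (x - y) (c * + half) (+ 2) (trans (trans (lemma₁ x y) eq)
        (trans (cong₂ _*_ e q-even) (lemma₂ c (+ half))))
      where
      lemma₁ : ∀ x y → (x - y) * + 2 ≡ x + x - (y + y)
      lemma₁ = solve-∀
      lemma₂ : ∀ c h → c * (h + h) ≡ c * h * + 2
      lemma₂ = solve-∀
    parity : ∀ r → r ℕ.< 2 → k ≡ + r + (k /ℕ 2) * + 2 → x ≈ y ⊎ x ≈ y + + half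
    parity 0 _ e = inj₁ (multiple (k /ℕ 2) (trans (difference≡ _ e)
        (trans (lemma (k /ℕ 2) (+ half)) (cong (k /ℕ 2 *_) (sym q-even)))))
      where
      lemma : ∀ t h → (0ℤ + t * + 2) * h ≡ t * (h + h)
      lemma = solve-∀
    parity 1 _ e = inj₂ (multiple (k /ℕ 2) (trans (lemma₁ x y (+ half)) (trans (cong (_- + half) (difference≡ _ e))
        (trans (lemma₂ (k /ℕ 2) (+ half)) (cong (k /ℕ 2 *_) (sym q-even))))))
      where
      lemma₁ : ∀ x y h → x - (y + h) ≡ x - y - h
      lemma₁ = solve-∀
      lemma₂ : ∀ t h → (1ℤ + t * + 2) * h - h ≡ t * (h + h)
      lemma₂ = solve-∀
    parity (suc (suc _)) (ℕ.s≤s (ℕ.s≤s ())) _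

  avoid-double : .{{_ : ℕ.NonZero q}} → ∀ c → Generic 2 (λ j → j + j ≉ c)
  avoid-double c with Finₚ.any? (λ (i : Fin q) → + toℕ i + + toℕ i ≈? c)
  ... | yes (i , e) = outside (+ toℕ i Vec.∷ + toℕ i + + half Vec.∷ Vec.[]) λ { j (a All.∷ b All.∷ All.[]) d →
          Sum.[ a , b ] (halve (≈-trans d (≈-sym e))) }
  -- No double is congruent to c here; the two zeros only fill the count.
  ... | no none = outside (0ℤ Vec.∷ 0ℤ Vec.∷ Vec.[]) λ j _ d → none (red q j , ≈-trans (red-≈ j ⊞ red-≈ j) d)

  double : .{{_ : ℕ.NonZero q}} → ∀ {n P} → Generic n P → Generic (n ℕ.* 2) (λ j → P (j + j))
  double (outside xs p) = weaken (λ j → p (j + j)) (doubles xs)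
    where
    doubles : ∀ {n} (xs : Vec ℤ n) → Generic (n ℕ.* 2) (λ j → All (j + j ≉_) xs)
    doubles Vec.[]       = outside Vec.[] λ _ _ → All.[]
    doubles (x Vec.∷ xs) = weaken (λ { j (a , as) → a All.∷ as }) (avoid-double x ⊗ doubles xs)

  record GoodColumn (g S : ℤ → ℤ) : Set where
    field
      S-cong : ∀ {m m′} → m ≈ m′ → S m ≈ S m′
      S-inj  : ∀ {m m′} → S m ≈ S m′ → m ≈ m′
      agrees : ∀ {m} → S m ≉ 0ℤ → g m ≈ S m

  module _ .{{_ : ℕ.NonZero q}} {g S : ℤ → ℤ} (G : GoodColumn g S) where
    open GoodColumn G

    S-surj : ∀ c → ∃ λ m → S m ≈ c
    S-surj = injective⇒surjective S S-inj

    avoid-value : ∀ c → Generic 1 (λ j → S j ≉ c)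
    avoid-value c with S-surj c
    ... | m , e = weaken (λ j a d → a (S-inj (≈-trans d (≈-sym e)))) (avoid m)

    avoid-double-value : ∀ c → Generic 2 (λ j → S j + S j ≉ c)
    avoid-double-value c with avoid-double c
    ... | outside (x Vec.∷ y Vec.∷ Vec.[]) p with avoid-value x ⊗ avoid-value y
    ...   | r = weaken (λ { j (a , b) → p (S j) (a All.∷ b All.∷ All.[]) }) r

  InRange : ℤ → Set
  InRange n = 1ℤ ℤ.≤ n × n ℤ.≤ + N

  -- A line n ↦ V n (j n + i), whose values are h n = α n + η wherever the latter is
  -- nonzero; at a zero of h the quotients by q form an affine function of slope α again.
  record Line (V : ℤ → ℤ → ℤ) (j i : ℤ) : Set where
    field α η : ℤ
    h : ℤ → ℤ
    h n = α * n + η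
    row : ℤ → ℤ
    row n = j * n + i
    field
      nontrivial : α ≈ 0ℤ → η ≉ 0ℤ
      value      : ∀ {n} → InRange n → h n ≉ 0ℤ → V n (row n) ≈ h n
      deeper     : ∀ {n} → InRange n → InRange (+ q + n) → h n ≈ 0ℤ → ∃ λ κ →
                   (κ ≉ 0ℤ → V n (row n) ≈ κ) × (κ + α ≉ 0ℤ → V (+ q + n) (row (+ q + n)) ≈ κ + α)

    row-next : ∀ n → row (sucℤ n) ≡ row n + j
    row-next n = lemma j i n
      where
      lemma : ∀ j i n → j * (1ℤ + n) + i ≡ j * n + i + j
      lemma = solve-∀

    row-far : ∀ n → row (+ q + n) ≡ row n + j * + q
    row-far n = lemma j i n (+ q)
      where
      lemma : ∀ j i n q → j * (q + n) + i ≡ j * n + i + j * q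
      lemma = solve-∀

    row-periodic : ∀ n → row n ≈ row (+ q + n)
    row-periodic n = multiple (- j) (lemma j i n (+ q))
      where
      lemma : ∀ j i n q → j * n + i - (j * (q + n) + i) ≡ - j * q
      lemma = solve-∀

    h-next : ∀ n → h (sucℤ n) ≈ h n + α
    h-next n = ≈-reflexive (lemma α η n)
      where
      lemma : ∀ j i n → j * (1ℤ + n) + i ≡ j * n + i + j
      lemma = solve-∀

    slope≉0 : ∀ {n} → h n ≈ 0ℤ → α ≉ 0ℤ
    slope≉0 {n} h≈0 α≈0 = nontrivial α≈0 (h≈0 ⊟ scale n α≈0 via lemma α η n)
      where
      lemma : ∀ α η n → η - 0ℤ ≡ α * n + η - n * α - (0ℤ - n * 0ℤ)
      lemma = solve-∀

  record Solution (V S : ℤ → ℤ → ℤ) : Set where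
    field
      nonzero : ∀ {n m} → InRange n → V n m ≉ 0ℤ
      line    : ∀ j i → Line V j i
      column  : ∀ {n} → InRange n → GoodColumn (V n) (S n)

-- Lines through the zeros of columns

module Columns (q half N : ℕ) (q-even : + q ≡ + half + + half) .{{_ : ℕ.NonZero q}} (q-large : 256 ℕ.≤ q)
  {V S : ℤ → ℤ → ℤ} (sol : Boards.Solution q half N q-even V S) where
  open Congruence q
  open Boards q half N q-even
  open Solution sol

  S-cong : ∀ {n m m′} → InRange n → m ≈ m′ → S n m ≈ S n m′
  S-cong r = GoodColumn.S-cong (column r)

  through : ∀ j c m → Line V j (m - j * c)
  through j c m = line j (m - j * c)

  row-through : ∀ j c m → Line.row (through j c m) c ≡ m
  row-through = lemma
    where
    lemma : ∀ j c m → j * c + (m - j * c) ≡ m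
    lemma = solve-∀

  module _ {j i} (ℓ : Line V j i) where
    open Line ℓ

    -- The column describes the entry by S, the line by h; where both are nonzero, they agree with
    -- the entry and hence with each other.
    value-S : ∀ {n m} → InRange n → row n ≈ m → h n ≉ 0ℤ → S n m ≉ 0ℤ → S n m ≈ h n
    value-S r e h≉0 x≉0 = ≈-trans (≈-sym Se) (≈-trans (≈-sym (GoodColumn.agrees (column r) x′≉0)) (value r h≉0))
      where
      Se = S-cong r e
      x′≉0 = x≉0 ∘ ≈-trans (≈-sym Se)

    -- If h vanished at n, then the quotients by q along the line would be κ at n and
    -- κ + α at n + q, while α is the value at n + 1: this leaves three values for α.
    no-false-zero : ∀ {n m m₁ p} → InRange n → InRange (sucℤ n) → InRange (+ q + n) →
      row n ≈ m → row (sucℤ n) ≈ m₁ → row (+ q + n) ≡ p → S n m ≉ 0ℤ → S (sucℤ n) m₁ ≉ 0ℤ →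
      S (sucℤ n) m₁ ≉ V (+ q + n) p → S (sucℤ n) m₁ ≉ V (+ q + n) p - S n m → S (sucℤ n) m₁ ≉ - S n m →
      h n ≈ S n m
    no-false-zero {n} {m} {m₁} r₀ r₁ rq e₀ e₁ refl x≉0 s≉0 s≉X s≉X-x s≉-x with h n ≈? 0ℤ
    ... | no  h≉0 = ≈-sym (value-S r₀ e₀ h≉0 x≉0)
    ... | yes h≈0 = ⊥-elim (exclude (deeper r₀ rq h≈0))
      where
      α≉0 = slope≉0 h≈0
      h₁≈α : h (sucℤ n) ≈ α
      h₁≈α = core (h-next n) h≈0
        where
        core : ∀ {h₁ h₀ α} → h₁ ≈ h₀ + α → h₀ ≈ 0ℤ → h₁ ≈ α
        core {h₁} {h₀} {α} p p₀ = p ⊞ p₀ via solve (h₁ ∷ h₀ ∷ α ∷ [])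
      s≈α : S (sucℤ n) m₁ ≈ α
      s≈α = ≈-trans (value-S r₁ e₁ (α≉0 ∘ ≈-trans (≈-sym h₁≈α)) s≉0) h₁≈α
      x≈V : S n m ≈ V n (row n)
      x≈V = ≈-trans (≈-sym Se) (≈-sym (GoodColumn.agrees (column r₀) (x≉0 ∘ ≈-trans (≈-sym Se))))
        where Se = S-cong r₀ e₀
      exclude : (∃ λ κ → (κ ≉ 0ℤ → V n (row n) ≈ κ) × (κ + α ≉ 0ℤ → V (+ q + n) (row (+ q + n)) ≈ κ + α)) → ⊥
      exclude (κ , v , w) with κ ≈? 0ℤ | κ + α ≈? 0ℤ
      ... | yes k | yes l = α≉0 (core l k)
        where
        core : ∀ {κ α} → κ + α ≈ 0ℤ → κ ≈ 0ℤ → α ≈ 0ℤ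
        core {κ} {α} l k = l ⊟ k via solve (κ ∷ α ∷ [])
      ... | yes k | no l = s≉X (core s≈α k (w l))
        where
        core : ∀ {κ α s X} → s ≈ α → κ ≈ 0ℤ → X ≈ κ + α → s ≈ X
        core {κ} {α} {s} {X} a k x = a ⊟ k ⊟ x via solve (κ ∷ α ∷ s ∷ X ∷ [])
      ... | no k | yes l = s≉-x (core s≈α l (≈-trans x≈V (v k)))
        where
        core : ∀ {κ α s x} → s ≈ α → κ + α ≈ 0ℤ → x ≈ κ → s ≈ - x
        core {κ} {α} {s} {x} a l x≈κ = a ⊞ l ⊞ x≈κ via solve (κ ∷ α ∷ s ∷ x ∷ [])
      ... | no k | no l = s≉X-x (core s≈α (w l) (≈-trans x≈V (v k)))
        where
        core : ∀ {κ α s X x} → s ≈ α → X ≈ κ + α → x ≈ κ → s ≈ X - x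
        core {κ} {α} {s} {X} {x} a b x≈κ = a ⊟ b ⊞ x≈κ via solve (κ ∷ α ∷ s ∷ X ∷ x ∷ [])

    -- The excluded values are those that a zero of h would force: h = 0 in column n + 1 gives -y in
    -- column n + 2, and h = 0 in column n + 2 gives 2s ≈ y for the value s in between.
    progression : ∀ {n m₁ m₂ y} → InRange (sucℤ n) → InRange (sucℤ (sucℤ n)) →
      row (sucℤ n) ≈ m₁ → row (sucℤ (sucℤ n)) ≈ m₂ → h n ≈ y → y ≉ 0ℤ →
      S (sucℤ n) m₁ ≉ 0ℤ → S (sucℤ n) m₁ + S (sucℤ n) m₁ ≉ y → S (sucℤ (sucℤ n)) m₂ ≉ 0ℤ → S (sucℤ (sucℤ n)) m₂ ≉ - y →
      S (sucℤ (sucℤ n)) m₂ ≈ S (sucℤ n) m₁ + S (sucℤ n) m₁ - y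
    progression {n} {m₁} {m₂} {y} r₁ r₂ e₁ e₂ hy y≉0 s≉0 2s≉y t≉0 t≉-y with h (sucℤ n) ≈? 0ℤ
    ... | yes h₁≈0 = contradiction (≈-trans (value-S r₂ e₂ h₂≉0 t≉0) h₂≈-y) t≉-y
      where
      core : ∀ {h₂ h₁ h₀ α y} → h₂ ≈ h₁ + α → h₁ ≈ h₀ + α → h₁ ≈ 0ℤ → h₀ ≈ y → h₂ ≈ - y
      core {h₂} {h₁} {h₀} {α} {y} p₂ p₁ z p = p₂ ⊟ p₁ ⊞ (z ⊞ z) ⊟ p via solve (h₂ ∷ h₁ ∷ h₀ ∷ α ∷ y ∷ [])
      h₂≈-y = core (h-next (sucℤ n)) (h-next n) h₁≈0 hy
      h₂≉0 : h (sucℤ (sucℤ n)) ≉ 0ℤ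
      h₂≉0 z = y≉0 (core′ h₂≈-y z)
        where
        core′ : ∀ {h₂ y} → h₂ ≈ - y → h₂ ≈ 0ℤ → y ≈ 0ℤ
        core′ {h₂} {y} p z = p ⊟ z via solve (h₂ ∷ y ∷ [])
    ... | no h₁≉0 = ≈-trans (value-S r₂ e₂ h₂≉0 t≉0) h₂≈
      where
      core : ∀ {h₂ h₁ h₀ α y s} → h₂ ≈ h₁ + α → h₁ ≈ h₀ + α → s ≈ h₁ → h₀ ≈ y → h₂ ≈ s + s - y
      core {h₂} {h₁} {h₀} {α} {y} {s} p₂ p₁ e p = p₂ ⊟ p₁ ⊟ (e ⊞ e) ⊟ p via solve (h₂ ∷ h₁ ∷ h₀ ∷ α ∷ y ∷ s ∷ [])
      h₂≈ = core (h-next (sucℤ n)) (h-next n) (value-S r₁ e₁ h₁≉0 s≉0) hy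
      h₂≉0 : h (sucℤ (sucℤ n)) ≉ 0ℤ
      h₂≉0 z = 2s≉y (core′ {s = S (sucℤ n) m₁} h₂≈ z)
        where
        core′ : ∀ {h₂ y s} → h₂ ≈ s + s - y → h₂ ≈ 0ℤ → s + s ≈ y
        core′ {h₂} {y} {s} p z = z ⊟ p via solve (h₂ ∷ y ∷ s ∷ [])

  open Line

  -- Suppose h = y ≉ 0 at n.  The column n takes the value y = S n m at some other row m, and the
  -- line through m which meets the given one in column n + 1 meets it again in column n + 2.
  zero-on-lines : ∀ {n z} → InRange n → InRange (sucℤ n) → InRange (sucℤ (sucℤ n)) → InRange (+ q + n) →
    S n z ≈ 0ℤ → Generic 14 (λ j → ∀ {i} (ℓ : Line V j i) → row ℓ n ≡ z → h ℓ n ≈ 0ℤ)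
  zero-on-lines {n} {z} r₀ r₁ r₂ rq Sz≈0 with S-surj (column r₀) (V n z)
  ... | m , Sm≈V = weaken body (shift z (avoid-value (column r₁) 0ℤ ⊗ avoid-value (column r₁) X
          ⊗ avoid-value (column r₁) (X - y) ⊗ avoid-value (column r₁) (- y) ⊗ avoid-double-value (column r₁) y)
      ⊗ double (shift z (avoid-value (column r₂) 0ℤ ⊗ avoid-value (column r₂) (- y)))
      ⊗ double (shift (z + z - m) (avoid-value (column r₂) 0ℤ ⊗ avoid-value (column r₂) (- y))))
    where
    X = V (+ q + n) m
    y = S n m
    y≉0 : y ≉ 0ℤ
    y≉0 = nonzero r₀ ∘ ≈-trans (≈-sym Sm≈V)
    body : ∀ j → _ → ∀ {i} (ℓ : Line V j i) → row ℓ n ≡ z → h ℓ n ≈ 0ℤ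
    body j ((s≉0 , s≉X , s≉X-y , s≉-y , 2s≉y) , (t≉0 , t≉-y) , (u≉0 , u≉-y)) ℓ refl =
      decidable-stable (h ℓ n ≈? 0ℤ) λ h≉0 → y≉0 (≈-trans (S-cong r₀ (rows-agree (≈-trans
        (progression ℓ r₁ r₂ ℓ₁ ℓ₂ (≈-trans (≈-sym (value ℓ r₀ h≉0)) (≈-sym Sm≈V)) y≉0 s≉0 2s≉y t≉0 t≉-y)
        (≈-sym (progression ℓ′ r₁ r₂ ℓ′₁ ℓ′₂
          (no-false-zero ℓ′ r₀ r₁ rq ℓ′₀ ℓ′₁ (row-through j′ (+ q + n) m) y≉0 s≉0 s≉X s≉X-y s≉-y)
          y≉0 s≉0 2s≉y u≉0 u≉-y))))) Sz≈0)
      where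
      j′ = z + j - m
      -- Passing through row m of column n + q makes `X` independent of j; column n is then met at m
      -- only modulo q, which suffices for S.
      ℓ′ = through j′ (+ q + n) m
      ℓ₁ : row ℓ (sucℤ n) ≈ z + j
      ℓ₁ = ≈-reflexive (row-next ℓ n)
      ℓ₂ : row ℓ (sucℤ (sucℤ n)) ≈ z + (j + j)
      ℓ₂ = ≈-reflexive (trans (row-next ℓ (sucℤ n)) (trans (cong (_+ j) (row-next ℓ n)) (ℤₚ.+-assoc z j j)))
      ℓ′₀ : row ℓ′ n ≈ m
      ℓ′₀ = ≈-trans (row-periodic ℓ′ n) (≈-reflexive (row-through j′ (+ q + n) m))
      ℓ′₁ : row ℓ′ (sucℤ n) ≈ z + j
      ℓ′₁ = core (≈-reflexive (row-next ℓ′ n)) ℓ′₀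
        where
        core : ∀ {r₁ r₀} → r₁ ≈ r₀ + j′ → r₀ ≈ m → r₁ ≈ z + j
        core {r₁} {r₀} p e = p ⊞ e via lemma r₁ r₀ z j m
          where
          lemma : ∀ r₁ r₀ z j m → r₁ - (z + j) ≡ r₁ + r₀ - (r₀ + (z + j - m) + m)
          lemma = solve-∀
      ℓ′₂ : row ℓ′ (sucℤ (sucℤ n)) ≈ z + z - m + (j + j)
      ℓ′₂ = core (≈-reflexive (row-next ℓ′ (sucℤ n))) ℓ′₁
        where
        core : ∀ {r₂ r₁} → r₂ ≈ r₁ + j′ → r₁ ≈ z + j → r₂ ≈ z + z - m + (j + j)
        core {r₂} {r₁} p e = p ⊞ e via lemma r₂ r₁ z j m
          where
          lemma : ∀ r₂ r₁ z j m → r₂ - (z + z - m + (j + j)) ≡ r₂ + r₁ - (r₁ + (z + j - m) + (z + j))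
          lemma = solve-∀
      -- Both lines have the same value in column n + 2, hence the same row modulo q. This gives m ≈
      -- z and so y ≈ 0, a contradiction.
      rows-agree : S (sucℤ (sucℤ n)) (z + (j + j)) ≈ S (sucℤ (sucℤ n)) (z + z - m + (j + j)) → m ≈ z
      rows-agree e = GoodColumn.S-inj (column r₂) e via lemma z j m
        where
        lemma : ∀ z j m → m - z ≡ z + (j + j) - (z + z - m + (j + j))
        lemma = solve-∀

  -- For most slopes h vanishes at the zero w of the middle column, so the entries on either side
  -- are -α and α.
  opposite : ∀ {n w} → InRange n → InRange (sucℤ n) → InRange (sucℤ (sucℤ n)) → InRange (sucℤ (sucℤ (sucℤ n))) →
    InRange (+ q + sucℤ n) → S (sucℤ n) w ≈ 0ℤ → Generic 16 (λ j → S n (w - j) + S (sucℤ (sucℤ n)) (w + j) ≈ 0ℤ)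
  opposite {n} {w} r₀ r₁ r₂ r₃ rq Sw≈0 = weaken body (zero-on-lines r₁ r₂ r₃ rq Sw≈0
      ⊗ reflect w (avoid-value (column r₀) 0ℤ) ⊗ shift w (avoid-value (column r₂) 0ℤ))
    where
    body : ∀ j → _ → S n (w - j) + S (sucℤ (sucℤ n)) (w + j) ≈ 0ℤ
    body j (vanish , s≉0 , t≉0) = core₃ (value-S ℓ r₀ ℓ₀ (α≉0 ∘ core₁ h₁≈0 (h-next ℓ n)) s≉0)
        (value-S ℓ r₂ ℓ₂ (α≉0 ∘ core₂ h₁≈0 (h-next ℓ (sucℤ n))) t≉0) (h-next ℓ n) (h-next ℓ (sucℤ n)) h₁≈0
      where
      ℓ = through j (sucℤ n) w
      h₁≈0 = vanish ℓ (row-through j (sucℤ n) w)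
      α≉0 = slope≉0 ℓ h₁≈0
      ℓ₀ : row ℓ n ≈ w - j
      ℓ₀ = core (row-next ℓ n) (row-through j (sucℤ n) w)
        where
        core : ∀ {r₁ r₀} → r₁ ≡ r₀ + j → r₁ ≡ w → r₀ ≈ w - j
        core {r₁} {r₀} p refl = ≈-reflexive (sym p) via lemma r₁ r₀ j
          where
          lemma : ∀ r₁ r₀ j → r₀ - (r₁ - j) ≡ r₀ + j - r₁
          lemma = solve-∀
      ℓ₂ : row ℓ (sucℤ (sucℤ n)) ≈ w + j
      ℓ₂ = ≈-reflexive (trans (row-next ℓ (sucℤ n)) (cong (_+ j) (row-through j (sucℤ n) w)))
      core₁ : ∀ {h₁ h₀ α} → h₁ ≈ 0ℤ → h₁ ≈ h₀ + α → h₀ ≈ 0ℤ → α ≈ 0ℤ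
      core₁ {h₁} {h₀} {α} z p y = z ⊟ p ⊟ y via solve (h₁ ∷ h₀ ∷ α ∷ [])
      core₂ : ∀ {h₂ h₁ α} → h₁ ≈ 0ℤ → h₂ ≈ h₁ + α → h₂ ≈ 0ℤ → α ≈ 0ℤ
      core₂ {h₂} {h₁} {α} z p y = y ⊟ p ⊟ z via solve (h₂ ∷ h₁ ∷ α ∷ [])
      core₃ : ∀ {h₂ h₁ h₀ α s t} → s ≈ h₀ → t ≈ h₂ → h₁ ≈ h₀ + α → h₂ ≈ h₁ + α → h₁ ≈ 0ℤ → s + t ≈ 0ℤ
      core₃ {h₂} {h₁} {h₀} {α} {s} {t} a b p₁ p₂ z =
        a ⊞ b ⊟ p₁ ⊞ p₂ ⊞ (z ⊞ z) via solve (h₂ ∷ h₁ ∷ h₀ ∷ α ∷ s ∷ t ∷ [])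

  -- By `no-false-zero`, h takes the value x = S (n + 1) v in the middle, so its values on the two
  -- sides add up to 2x. A zero on one side would put 2x on the other, which is excluded.
  mean : ∀ {n v} → InRange n → InRange (sucℤ n) → InRange (sucℤ (sucℤ n)) → InRange (+ q + sucℤ n) →
    S (sucℤ n) v + S (sucℤ n) v ≉ 0ℤ →
    Generic 7 (λ j → S n (v - j) + S (sucℤ (sucℤ n)) (v + j) ≈ S (sucℤ n) v + S (sucℤ n) v)
  mean {n} {v} r₀ r₁ r₂ rq 2x≉0 = weaken body (shift v (avoid-value (column r₂) 0ℤ ⊗ avoid-value (column r₂) X
      ⊗ avoid-value (column r₂) (X - x) ⊗ avoid-value (column r₂) (- x) ⊗ avoid-value (column r₂) (x + x))
      ⊗ reflect v (avoid-value (column r₀) 0ℤ ⊗ avoid-value (column r₀) (x + x)))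
    where
    X = V (+ q + sucℤ n) v
    x = S (sucℤ n) v
    body : ∀ j → _ → S n (v - j) + S (sucℤ (sucℤ n)) (v + j) ≈ x + x
    body j ((t≉0 , t≉X , t≉X-x , t≉-x , t≉2x) , s≉0 , s≉2x) =
      core₁ (value-S ℓ r₀ ℓ₀ h₀≉0 s≉0) (value-S ℓ r₂ ℓ₂ h₂≉0 t≉0) h₁≈x (h-next ℓ n) (h-next ℓ (sucℤ n))
      where
      ℓ = through j (+ q + sucℤ n) v
      ℓ₁ : row ℓ (sucℤ n) ≈ v
      ℓ₁ = ≈-trans (row-periodic ℓ (sucℤ n)) (≈-reflexive (row-through j (+ q + sucℤ n) v))
      ℓ₀ : row ℓ n ≈ v - j
      ℓ₀ = core (≈-reflexive (row-next ℓ n)) ℓ₁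
        where
        core : ∀ {r₁ r₀} → r₁ ≈ r₀ + j → r₁ ≈ v → r₀ ≈ v - j
        core {r₁} {r₀} p e = e ⊟ p via solve (r₁ ∷ r₀ ∷ j ∷ v ∷ [])
      ℓ₂ : row ℓ (sucℤ (sucℤ n)) ≈ v + j
      ℓ₂ = ≈-trans (≈-reflexive (row-next ℓ (sucℤ n))) (ℓ₁ ⊞ ≈-refl)
      h₁≈x : h ℓ (sucℤ n) ≈ x
      h₁≈x = no-false-zero ℓ r₁ r₂ rq ℓ₁ ℓ₂ (row-through j (+ q + sucℤ n) v)
        (λ x≈0 → 2x≉0 (x≈0 ⊞ x≈0)) t≉0 t≉X t≉X-x t≉-x
      core₁ : ∀ {h₂ h₁ h₀ α s t x} → s ≈ h₀ → t ≈ h₂ → h₁ ≈ x → h₁ ≈ h₀ + α → h₂ ≈ h₁ + α → s + t ≈ x + x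
      core₁ {h₂} {h₁} {h₀} {α} {s} {t} {x} a b p p₁ p₂ =
        a ⊞ b ⊟ p₁ ⊞ p₂ ⊞ (p ⊞ p) via solve (h₂ ∷ h₁ ∷ h₀ ∷ α ∷ s ∷ t ∷ x ∷ [])
      h₀+h₂ : h ℓ n + h ℓ (sucℤ (sucℤ n)) ≈ x + x
      h₀+h₂ = core₁ (≈-refl {h ℓ n}) ≈-refl h₁≈x (h-next ℓ n) (h-next ℓ (sucℤ n))
      other : ∀ {a b c} → a + b ≈ c → a ≈ 0ℤ → b ≈ c
      other {a} {b} {c} p z = p ⊟ z via solve (a ∷ b ∷ c ∷ [])
      other′ : ∀ {a b c} → a + b ≈ c → b ≈ 0ℤ → a ≈ c
      other′ {a} {b} {c} p z = p ⊟ z via solve (a ∷ b ∷ c ∷ [])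
      h₀≉0 : h ℓ n ≉ 0ℤ
      h₀≉0 z = t≉2x (≈-trans (value-S ℓ r₂ ℓ₂ (2x≉0 ∘ ≈-trans (≈-sym h₂≈2x)) t≉0) h₂≈2x)
        where h₂≈2x = other h₀+h₂ z
      h₂≉0 : h ℓ (sucℤ (sucℤ n)) ≉ 0ℤ
      h₂≉0 z = s≉2x (≈-trans (value-S ℓ r₀ ℓ₀ (2x≉0 ∘ ≈-trans (≈-sym h₀≈2x)) s≉0) h₀≈2x)
        where h₀≈2x = other′ h₀+h₂ z

  -- Subtract `opposite` at w from `mean` at w + k, with slopes chosen so that both use the same
  -- entry of column n + 2. Translation by 2k thus changes column n by an amount that does not
  -- depend on m.
  difference-constant : ∀ {n w} → InRange n → InRange (sucℤ n) → InRange (sucℤ (sucℤ n)) → InRange (sucℤ (sucℤ (sucℤ n))) →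
    InRange (+ q + sucℤ n) → S (sucℤ n) w ≈ 0ℤ → ∀ k → S (sucℤ n) (w + k) + S (sucℤ n) (w + k) ≉ 0ℤ →
    Generic 23 (λ m → S n m - S n (m - (k + k)) ≈ S (sucℤ n) (w + k) + S (sucℤ n) (w + k))
  difference-constant {n} {w} r₀ r₁ r₂ r₃ rq Sw≈0 k 2x≉0 = weaken body
      (reflect (w + k) (mean r₀ r₁ r₂ rq 2x≉0) ⊗ reflect (w + (k + k)) (opposite r₀ r₁ r₂ r₃ rq Sw≈0))
    where
    body : ∀ m → _ → S n m - S n (m - (k + k)) ≈ S (sucℤ n) (w + k) + S (sucℤ n) (w + k)
    body m (p , o) = core p o (S-cong r₀ (≈-reflexive (lemma₁ w k m))) (S-cong r₀ (≈-reflexive (lemma₂ w k m)))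
        (S-cong r₂ (≈-reflexive (lemma₃ w k m)))
      where
      core : ∀ {a b c d e f x} → a + b ≈ x → c + d ≈ 0ℤ → a ≈ e → c ≈ f → b ≈ d → e - f ≈ x
      core {a} {b} {c} {d} {e} {f} {x} p o ae cf bd =
        p ⊟ o ⊟ ae ⊞ cf ⊟ bd via solve (a ∷ b ∷ c ∷ d ∷ e ∷ f ∷ x ∷ [])
      lemma₁ : ∀ w k m → w + k - (w + k - m) ≡ m
      lemma₁ = solve-∀
      lemma₂ : ∀ w k m → w - (w + (k + k) - m) ≡ m - (k + k)
      lemma₂ = solve-∀
      lemma₃ : ∀ w k m → w + k + (w + k - m) ≡ w + (w + (k + k) - m)
      lemma₃ = solve-∀

  -- For most slopes, h is 0, α, 2α in the three columns, starting at the zero z.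
  from-left : ∀ {n z} → InRange n → InRange (sucℤ n) → InRange (sucℤ (sucℤ n)) → InRange (+ q + n) → S n z ≈ 0ℤ →
    Generic 18 (λ j → S (sucℤ (sucℤ n)) (z + (j + j)) ≈ S (sucℤ n) (z + j) + S (sucℤ n) (z + j))
  from-left {n} {z} r₀ r₁ r₂ rq Sz≈0 = weaken body (zero-on-lines r₀ r₁ r₂ rq Sz≈0
      ⊗ shift z (avoid-double-value (column r₁) 0ℤ) ⊗ double (shift z (avoid-value (column r₂) 0ℤ)))
    where
    body : ∀ j → _ → S (sucℤ (sucℤ n)) (z + (j + j)) ≈ S (sucℤ n) (z + j) + S (sucℤ n) (z + j)
    body j (vanish , 2s≉0 , t≉0) = ≈-trans (value-S ℓ r₂ ℓ₂ (2s≉0 ∘ ≈-trans (≈-sym h₂≈2s)) t≉0) h₂≈2s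
      where
      ℓ = through j n z
      h₀≈0 = vanish ℓ (row-through j n z)
      ℓ₁ : row ℓ (sucℤ n) ≈ z + j
      ℓ₁ = ≈-reflexive (trans (row-next ℓ n) (cong (_+ j) (row-through j n z)))
      ℓ₂ : row ℓ (sucℤ (sucℤ n)) ≈ z + (j + j)
      ℓ₂ = ≈-trans (≈-reflexive (row-next ℓ (sucℤ n))) (≈-trans (ℓ₁ ⊞ ≈-refl) (≈-reflexive (ℤₚ.+-assoc z j j)))
      core₁ : ∀ {h₁ h₀ α} → h₀ ≈ 0ℤ → h₁ ≈ h₀ + α → h₁ ≈ 0ℤ → α ≈ 0ℤ
      core₁ {h₁} {h₀} {α} z p y = y ⊟ p ⊟ z via solve (h₁ ∷ h₀ ∷ α ∷ [])
      core₂ : ∀ {h₂ h₁ h₀ α s} → s ≈ h₁ → h₀ ≈ 0ℤ → h₁ ≈ h₀ + α → h₂ ≈ h₁ + α → h₂ ≈ s + s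
      core₂ {h₂} {h₁} {h₀} {α} {s} e z p₁ p₂ =
        p₂ ⊟ p₁ ⊟ (e ⊞ e) ⊟ z via solve (h₂ ∷ h₁ ∷ h₀ ∷ α ∷ s ∷ [])
      h₂≈2s = core₂ (value-S ℓ r₁ ℓ₁ (slope≉0 ℓ h₀≈0 ∘ core₁ h₀≈0 (h-next ℓ n)) λ s≈0 → 2s≉0 (s≈0 ⊞ s≈0))
        h₀≈0 (h-next ℓ n) (h-next ℓ (sucℤ n))

  from-right : ∀ {n t} → InRange n → InRange (sucℤ n) → InRange (sucℤ (sucℤ n)) → InRange (sucℤ (sucℤ (sucℤ n))) →
    InRange (sucℤ (sucℤ (sucℤ (sucℤ n)))) → InRange (+ q + sucℤ (sucℤ n)) → S (sucℤ (sucℤ n)) t ≈ 0ℤ →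
    Generic 18 (λ j → S n (t - (j + j)) ≈ S (sucℤ n) (t - j) + S (sucℤ n) (t - j))
  from-right {n} {t} r₀ r₁ r₂ r₃ r₄ rq St≈0 = weaken body (zero-on-lines r₂ r₃ r₄ rq St≈0
      ⊗ reflect t (avoid-double-value (column r₁) 0ℤ) ⊗ double (reflect t (avoid-value (column r₀) 0ℤ)))
    where
    body : ∀ j → _ → S n (t - (j + j)) ≈ S (sucℤ n) (t - j) + S (sucℤ n) (t - j)
    body j (vanish , 2s≉0 , u≉0) = ≈-trans (value-S ℓ r₀ ℓ₀ (2s≉0 ∘ ≈-trans (≈-sym h₀≈2s)) u≉0) h₀≈2s
      where
      ℓ = through j (sucℤ (sucℤ n)) t
      h₂≈0 = vanish ℓ (row-through j (sucℤ (sucℤ n)) t)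
      core : ∀ {r₁ r₀ r} → r₁ ≈ r₀ + j → r₁ ≈ r → r₀ ≈ r - j
      core {r₁} {r₀} {r} p e = e ⊟ p via solve (r₁ ∷ r₀ ∷ j ∷ r ∷ [])
      ℓ₁ : row ℓ (sucℤ n) ≈ t - j
      ℓ₁ = core (≈-reflexive (row-next ℓ (sucℤ n))) (≈-reflexive (row-through j (sucℤ (sucℤ n)) t))
      ℓ₀ : row ℓ n ≈ t - (j + j)
      ℓ₀ = ≈-trans (core (≈-reflexive (row-next ℓ n)) ℓ₁) (≈-reflexive (lemma t j))
        where
        lemma : ∀ t j → t - j - j ≡ t - (j + j)
        lemma = solve-∀
      core₁ : ∀ {h₂ h₁ α} → h₂ ≈ 0ℤ → h₂ ≈ h₁ + α → h₁ ≈ 0ℤ → α ≈ 0ℤ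
      core₁ {h₂} {h₁} {α} z p y = z ⊟ p ⊟ y via solve (h₂ ∷ h₁ ∷ α ∷ [])
      core₂ : ∀ {h₂ h₁ h₀ α s} → s ≈ h₁ → h₂ ≈ 0ℤ → h₁ ≈ h₀ + α → h₂ ≈ h₁ + α → h₀ ≈ s + s
      core₂ {h₂} {h₁} {h₀} {α} {s} e z p₁ p₂ =
        p₂ ⊟ p₁ ⊟ (e ⊞ e) ⊟ z via solve (h₂ ∷ h₁ ∷ h₀ ∷ α ∷ s ∷ [])
      h₀≈2s = core₂ (value-S ℓ r₁ ℓ₁ (slope≉0 ℓ h₂≈0 ∘ core₁ h₂≈0 (h-next ℓ (sucℤ n))) λ s≈0 → 2s≉0 (s≈0 ⊞ s≈0))
        h₂≈0 (h-next ℓ n) (h-next ℓ (sucℤ n))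

  pick : ∀ {n P} {_ : True (suc n ℕ.≤? 256)} → Generic n P → ∃ P
  pick {_} {_} {small} = generic-exists (ℕₚ.≤-trans (toWitness small) q-large)

  -- `zero-on-lines` at column c uses c, c + 1, c + 2 and c + q; it is applied for c = n, n + 1, n +
  -- 2.
  record Room (n : ℤ) : Set where
    field
      r₀ : InRange n
      r₁ : InRange (sucℤ n)
      r₂ : InRange (sucℤ (sucℤ n))
      r₃ : InRange (sucℤ (sucℤ (sucℤ n)))
      r₄ : InRange (sucℤ (sucℤ (sucℤ (sucℤ n))))
      s₀ : InRange (+ q + n)
      s₁ : InRange (+ q + sucℤ n)
      s₂ : InRange (+ q + sucℤ (sucℤ n))

  -- Zeros of three consecutive columns

  module _ {n : ℤ} (room : Room n) where
    open Room room

    -- Translate column n by 2 (v - w) and back: the two changes given by `difference-constant`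
    -- cancel.
    antisymmetric : ∀ {w} → S (sucℤ n) w ≈ 0ℤ → ∀ v → S (sucℤ n) v + S (sucℤ n) v ≉ 0ℤ →
      S (sucℤ n) (w + w - v) + S (sucℤ n) (w + w - v) ≉ 0ℤ →
      (S (sucℤ n) v + S (sucℤ n) v) + (S (sucℤ n) (w + w - v) + S (sucℤ n) (w + w - v)) ≈ 0ℤ
    antisymmetric {w} Sw≈0 v 2x≉0 2y≉0 = combine (pick (difference v≈ 2x≉0 ⊗ shift (- (k + k)) (difference v′≈ 2y≉0)))
      where
      k k′ : ℤ
      k  = v - w
      k′ = w - v
      v≈ : w + k ≡ v
      v≈ = lemma v w
        where
        lemma : ∀ v w → w + (v - w) ≡ v
        lemma = solve-∀
      v′≈ : w + k′ ≡ w + w - v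
      v′≈ = sym (ℤₚ.+-assoc w w (- v))
      difference : ∀ {k v} → w + k ≡ v → S (sucℤ n) v + S (sucℤ n) v ≉ 0ℤ →
        Generic 23 (λ m → S n m - S n (m - (k + k)) ≈ S (sucℤ n) v + S (sucℤ n) v)
      difference {k} refl = difference-constant r₀ r₁ r₂ r₃ s₁ Sw≈0 k
      combine : (∃ λ m → S n m - S n (m - (k + k)) ≈ S (sucℤ n) v + S (sucℤ n) v ×
          S n (- (k + k) + m) - S n (- (k + k) + m - (k′ + k′)) ≈ S (sucℤ n) (w + w - v) + S (sucℤ n) (w + w - v)) → _
      combine (m , d , e) = core d e (S-cong r₀ (≈-reflexive (ℤₚ.+-comm m _))) (S-cong r₀ (≈-reflexive (lemma m v w)))
        where
        core : ∀ {a b b′ a′ x y} → a - b ≈ x → b′ - a′ ≈ y → b ≈ b′ → a ≈ a′ → x + y ≈ 0ℤ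
        core {a} {b} {b′} {a′} {x} {y} d e bb aa = ≈-sym (d ⊞ e ⊞ bb ⊟ aa
          via solve (a ∷ b ∷ b′ ∷ a′ ∷ x ∷ y ∷ []))
        lemma : ∀ m v w → m ≡ - (v - w + (v - w)) + m - (w - v + (w - v))
        lemma = solve-∀

    -- Write S₀, S₁, S₂ for the three columns and take v generic. Then S₀ (2v - t) ≈ 2 S₁ v by
    -- `from-right`, and S₂ (4w - z - 2v) ≈ 2 S₁ (2w - v) by `from-left`; these are opposite by
    -- `antisymmetric`. By `opposite`, S₀ (z + 2v - 2w) is also the negative of the second, so
    -- injectivity of S₀ gives 2v - t ≈ z + 2v - 2w.
    zeros-aligned : ∀ {z w t} → S n z ≈ 0ℤ → S (sucℤ n) w ≈ 0ℤ → S (sucℤ (sucℤ n)) t ≈ 0ℤ → w + w ≈ z + t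
    zeros-aligned {z} {w} {t} Sz≈0 Sw≈0 St≈0 = combine (pick
      (avoid-double-value (column r₁) 0ℤ ⊗ reflect (w + w) (avoid-double-value (column r₁) 0ℤ)
        ⊗ reflect (w + w - z) (from-left r₀ r₁ r₂ s₀ Sz≈0) ⊗ reflect t (from-right r₀ r₁ r₂ r₃ r₄ s₂ St≈0)
        ⊗ double (reflect (w + w + w - z) (opposite r₀ r₁ r₂ r₃ s₁ Sw≈0))))
      where
      combine : _ → w + w ≈ z + t
      combine (v , 2x≉0 , 2y≉0 , l , r , o) = GoodColumn.S-inj (column r₀)
          (core l r o (antisymmetric Sw≈0 v 2x≉0 2y≉0) (S-cong r₁ (≈-reflexive (lemma₁ z w v)))
            (S-cong r₁ (≈-reflexive (lemma₂ t v))) (S-cong r₂ (≈-reflexive (lemma₃ z w v))))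
          via lemma₄ z w t v
        where
        core : ∀ {c d x x′ y y′ a b} → c ≈ y + y → a ≈ x + x → b + d ≈ 0ℤ → (x′ + x′) + (y′ + y′) ≈ 0ℤ →
          y ≈ y′ → x ≈ x′ → c ≈ d → a ≈ b
        core {c} {d} {x} {x′} {y} {y′} {a} {b} l r o s yy xx cd =
          r ⊞ l ⊟ o ⊞ s ⊞ (yy ⊞ yy) ⊞ (xx ⊞ xx) ⊟ cd via solve (c ∷ d ∷ x ∷ x′ ∷ y ∷ y′ ∷ a ∷ b ∷ [])
        lemma₁ : ∀ z w v → z + (w + w - z - v) ≡ w + w - v
        lemma₁ = solve-∀
        lemma₂ : ∀ t v → t - (t - v) ≡ v
        lemma₂ = solve-∀
        lemma₃ : ∀ z w v → z + (w + w - z - v + (w + w - z - v)) ≡ w + (w + w + w - z - (v + v))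
        lemma₃ = solve-∀
        lemma₄ : ∀ z w t v → w + w - (z + t) ≡ t - (t - v + (t - v)) - (w - (w + w + w - z - (v + v)))
        lemma₄ = solve-∀

    -- Good columns of the refined board

    module Refinement {z : ℤ} (Sz≈0 : S n z ≈ 0ℤ) where
      -- `x` is the refined column. The line of slope j through row z + q k of column n reaches
      -- column n + q at the entry `X (k + j)`, and for most j its α is `A j`.
      x X A : ℤ → ℤ
      x k = V n (z + + q * k)
      X l = V (+ q + n) (z + + q * l)
      A j = S (sucℤ n) (z + j)

      -- The cases κ ≈ 0 and κ ≈ `x k`. A priori κ depends on j as well as on k, so the case may
      -- change with j.
      Relation : ℤ → ℤ → Set
      Relation k j = X (k + j) ≈ A j ⊎ X (k + j) ≈ x k + A j

      x≉0 : ∀ k → x k ≉ 0ℤ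
      x≉0 k = nonzero r₀

      relation : ∀ k → Generic 16 (Relation k)
      relation k = weaken body (zero-on-lines r₀ r₁ r₂ s₀ (≈-trans (S-cong r₀ z′≈z) Sz≈0)
          ⊗ shift z (avoid-value (column r₁) 0ℤ ⊗ avoid-value (column r₁) (- x k)))
        where
        z′ = z + + q * k
        z′≈z : z′ ≈ z
        z′≈z = multiple k (lemma z k (+ q))
          where
          lemma : ∀ z k q → z + q * k - z ≡ k * q
          lemma = solve-∀
        body : ∀ j → _ → Relation k j
        body j (vanish , a≉0 , a≉-x) = split (deeper ℓ r₀ s₀ h≈0)
          where
          ℓ = through j n z′
          h≈0 = vanish ℓ (row-through j n z′)
          α≉0 = slope≉0 ℓ h≈0
          ℓ₁ : row ℓ (sucℤ n) ≈ z + j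
          ℓ₁ = ≈-trans (≈-reflexive (trans (row-next ℓ n) (cong (_+ j) (row-through j n z′)))) (z′≈z ⊞ ≈-refl)
          h₁≈α : h ℓ (sucℤ n) ≈ α ℓ
          h₁≈α = core (h-next ℓ n) h≈0
            where
            core : ∀ {h₁ h₀ α} → h₁ ≈ h₀ + α → h₀ ≈ 0ℤ → h₁ ≈ α
            core {h₁} {h₀} {α} p p₀ = p ⊞ p₀ via solve (h₁ ∷ h₀ ∷ α ∷ [])
          a≈α : A j ≈ α ℓ
          a≈α = ≈-trans (value-S ℓ r₁ ℓ₁ (α≉0 ∘ ≈-trans (≈-sym h₁≈α)) a≉0) h₁≈α
          far : row ℓ (+ q + n) ≡ z + + q * (k + j)
          far = trans (row-far ℓ n) (trans (cong (_+ j * + q) (row-through j n z′)) (lemma z k j (+ q)))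
            where
            lemma : ∀ z k j q → z + q * k + j * q ≡ z + q * (k + j)
            lemma = solve-∀
          split : (∃ λ κ → (κ ≉ 0ℤ → V n (row ℓ n) ≈ κ) ×
                    (κ + α ℓ ≉ 0ℤ → V (+ q + n) (row ℓ (+ q + n)) ≈ κ + α ℓ)) → Relation k j
          split (κ , v , w) with κ ≈? 0ℤ
          ... | yes κ≈0 = inj₁ (core₂ (subst (λ r → V (+ q + n) r ≈ κ + α ℓ) far (w (α≉0 ∘ core₁ κ≈0))) κ≈0 a≈α)
            where
            core₁ : ∀ {κ α} → κ ≈ 0ℤ → κ + α ≈ 0ℤ → α ≈ 0ℤ
            core₁ {κ} {α} k l = l ⊟ k via solve (κ ∷ α ∷ [])
            core₂ : ∀ {κ α X a} → X ≈ κ + α → κ ≈ 0ℤ → a ≈ α → X ≈ a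
            core₂ {κ} {α} {X} {a} p k e = p ⊞ k ⊟ e via solve (κ ∷ α ∷ X ∷ a ∷ [])
          ... | no κ≉0 = inj₂ (core₂ (subst (λ r → V (+ q + n) r ≈ κ + α ℓ) far (w (a≉-x ∘ core₁ x≈κ a≈α))) x≈κ a≈α)
            where
            x≈κ : x k ≈ κ
            x≈κ = subst (λ r → V n r ≈ κ) (row-through j n z′) (v κ≉0)
            core₁ : ∀ {κ α x a} → x ≈ κ → a ≈ α → κ + α ≈ 0ℤ → a ≈ - x
            core₁ {κ} {α} {x} {a} p e l = e ⊞ p ⊞ l via solve (κ ∷ α ∷ x ∷ a ∷ [])
            core₂ : ∀ {κ α X a x} → X ≈ κ + α → x ≈ κ → a ≈ α → X ≈ x + a
            core₂ {κ} {α} {X} {a} {x} p k e = p ⊟ k ⊟ e via solve (κ ∷ α ∷ X ∷ a ∷ x ∷ [])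

      -- The lines of slope j through k and of slope j - e through k + e end at the same
      -- `X (k + j)`, so their next digits differ by `d` whatever j is.
      record Shift : Set where
        field
          e d   : ℤ
          d≉0   : d ≉ 0ℤ
          const : Generic 23 (λ j → A j - A (- e + j) ≈ d)

      shift-by : ∀ {t} → S (sucℤ (sucℤ n)) t ≈ 0ℤ → ∀ k → S (sucℤ (sucℤ n)) (t + k) + S (sucℤ (sucℤ n)) (t + k) ≉ 0ℤ → Shift
      shift-by {t} St≈0 k 2x≉0 = record
        { e = k + k ; d = S (sucℤ (sucℤ n)) (t + k) + S (sucℤ (sucℤ n)) (t + k) ; d≉0 = 2x≉0
        ; const = weaken (λ j p → ≈-trans (≈-refl {A j} ⊟ S-cong r₁ (≈-reflexive (lemma z j k))) p)
            (shift z (difference-constant r₁ r₂ r₃ r₄ s₂ St≈0 k 2x≉0)) }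
        where
        lemma : ∀ z j k → z + (- (k + k) + j) ≡ z + j - (k + k)
        lemma = solve-∀

      -- A single shift leaves open that `x k` ≈ -d; a second one with another d rules this out.
      two-shifts : Σ Shift λ a → Σ Shift λ b → Shift.d a ≉ Shift.d b
      two-shifts =
        let t  , St≈0        = S-surj (column r₂) 0ℤ
            k₁ , 2x≉0        = pick (shift t (avoid-double-value (column r₂) 0ℤ))
            k₂ , 2y≉0 , 2y≉2x = pick (shift t (avoid-double-value (column r₂) 0ℤ ⊗
              avoid-double-value (column r₂) (S (sucℤ (sucℤ n)) (t + k₁) + S (sucℤ (sucℤ n)) (t + k₁))))
        in shift-by St≈0 k₁ 2x≉0 , shift-by St≈0 k₂ 2y≉0 , 2y≉2x ∘ ≈-sym

      module _ (k : ℤ) (a : Shift) where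
        open Shift a

        -- If κ = 0 on the line of slope j₀ through k and κ = x k on the one of slope j₁, then κ takes
        -- the values d and x k + d on the lines through k + e which meet these in the column n + q.
        clash : ∀ {j₀ j₁} → Relation (k + e) (- e + j₀) → Relation (k + e) (- e + j₁) →
          A j₀ - A (- e + j₀) ≈ d → A j₁ - A (- e + j₁) ≈ d →
          X (k + j₀) ≈ A j₀ → X (k + j₁) ≈ x k + A j₁ → x k + d ≈ 0ℤ
        clash {j₀} {j₁} R₀ R₁ D₀ D₁ P₀ P₁ = cases (subst₂ (λ l m → X l ≈ A (- e + j₀) ⊎ X m ≈ x (k + e) + A (- e + j₀)) (lemma k e j₀) (lemma k e j₀) R₀)
            (subst₂ (λ l m → X l ≈ A (- e + j₁) ⊎ X m ≈ x (k + e) + A (- e + j₁)) (lemma k e j₁) (lemma k e j₁) R₁)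
          where
          lemma : ∀ k e j → k + e + (- e + j) ≡ k + j
          lemma = solve-∀
          core₁ : ∀ {X A A′ d} → X ≈ A′ → A - A′ ≈ d → X ≈ A → d ≈ 0ℤ
          core₁ {X} {A} {A′} {d} p D P = p ⊟ D ⊟ P via solve (X ∷ A ∷ A′ ∷ d ∷ [])
          core₂ : ∀ {X A A′ d x} → X ≈ A′ → A - A′ ≈ d → X ≈ x + A → x + d ≈ 0ℤ
          core₂ {X} {A} {A′} {d} {x} p D P = p ⊟ D ⊟ P via solve (X ∷ A ∷ A′ ∷ d ∷ x ∷ [])
          core₃ : ∀ {X₀ A₀ A₀′ X₁ A₁ A₁′ d x x′} → X₀ ≈ x′ + A₀′ → A₀ - A₀′ ≈ d → X₀ ≈ A₀ →
            X₁ ≈ x′ + A₁′ → A₁ - A₁′ ≈ d → X₁ ≈ x + A₁ → x ≈ 0ℤ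
          core₃ {X₀} {A₀} {A₀′} {X₁} {A₁} {A₁′} {d} {x} {x′} p D P p′ D′ P′ =
            p′ ⊟ P′ ⊟ D′ ⊟ p ⊞ D ⊞ P via solve (X₀ ∷ A₀ ∷ A₀′ ∷ X₁ ∷ A₁ ∷ A₁′ ∷ d ∷ x ∷ x′ ∷ [])
          cases : X (k + j₀) ≈ A (- e + j₀) ⊎ X (k + j₀) ≈ x (k + e) + A (- e + j₀) →
            X (k + j₁) ≈ A (- e + j₁) ⊎ X (k + j₁) ≈ x (k + e) + A (- e + j₁) → x k + d ≈ 0ℤ
          cases (inj₁ p) _        = contradiction (core₁ {A = A j₀} p D₀ P₀) d≉0
          cases (inj₂ _) (inj₁ p) = core₂ {A = A j₁} {x = x k} p D₁ P₁
          cases (inj₂ p) (inj₂ r) = contradiction (core₃ {A₀ = A j₀} {A₁ = A j₁} {x = x k} {x (k + e)} p D₀ P₀ r D₁ P₁) (x≉0 k)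

      module _ (a b : Shift) (da≉db : Shift.d a ≉ Shift.d b) where
        private
          module a = Shift a
          module b = Shift b

        -- By `absurd`, all generic slopes fall into the same case of `Relation`. Hence X (k + j) -
        -- A j is constant, either 0 or `x k`, and can be read off at one generic slope j₀.
        intercept : ∀ k → ∃ λ y → (y ≉ 0ℤ → x k ≈ y) × Generic 94 (λ j → X (k + j) ≈ y + A j)
        intercept k = build (pick generic)
          where
          Pred : ℤ → Set
          Pred j = Relation k j × Relation (k + a.e) (- a.e + j) × Relation (k + b.e) (- b.e + j) ×
            A j - A (- a.e + j) ≈ a.d × A j - A (- b.e + j) ≈ b.d
          generic : Generic 94 Pred
          generic = relation k ⊗ shift (- a.e) (relation (k + a.e)) ⊗ shift (- b.e) (relation (k + b.e)) ⊗ a.const ⊗ b.const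
          first : ∀ {j₀} → Pred j₀ → X (k + j₀) - A j₀ ≉ 0ℤ → x k ≈ X (k + j₀) - A j₀
          first {j₀} (inj₁ p , _) y≉0 = contradiction (core {A = A j₀} p) y≉0
            where
            core : ∀ {X A} → X ≈ A → X - A ≈ 0ℤ
            core {X} {A} p = p via solve (X ∷ A ∷ [])
          first {j₀} (inj₂ p , _) _ = core {A = A j₀} {x k} p
            where
            core : ∀ {X A x} → X ≈ x + A → x ≈ X - A
            core {X} {A} {x} p = ≈-sym (p via solve (X ∷ A ∷ x ∷ []))
          absurd : ∀ {j j′} → Pred j → Pred j′ → X (k + j) ≈ A j → X (k + j′) ≈ x k + A j′ → ⊥
          absurd (_ , Ra , Rb , Da , Db) (_ , Ra′ , Rb′ , Da′ , Db′) P P′ =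
            da≉db (core {x = x k} (clash k a Ra Ra′ Da Da′ P P′) (clash k b Rb Rb′ Db Db′ P P′))
            where
            core : ∀ {x d d′} → x + d ≈ 0ℤ → x + d′ ≈ 0ℤ → d ≈ d′
            core {x} {d} {d′} p p′ = p ⊟ p′ via solve (x ∷ d ∷ d′ ∷ [])
          second : ∀ {j₀ j} → Pred j₀ → Pred j → X (k + j) ≈ X (k + j₀) - A j₀ + A j
          second {j₀} {j} (inj₁ p₀ , _) (inj₁ p , _) = core {A₀ = A j₀} {A = A j} p₀ p
            where
            core : ∀ {X₀ A₀ X A} → X₀ ≈ A₀ → X ≈ A → X ≈ X₀ - A₀ + A
            core {X₀} {A₀} {X} {A} p₀ p = p ⊟ p₀ via solve (X₀ ∷ A₀ ∷ X ∷ A ∷ [])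
          second {j₀} {j} (inj₂ p₀ , _) (inj₂ p , _) = core {A₀ = A j₀} {A = A j} {x k} p₀ p
            where
            core : ∀ {X₀ A₀ X A x} → X₀ ≈ x + A₀ → X ≈ x + A → X ≈ X₀ - A₀ + A
            core {X₀} {A₀} {X} {A} {x} p₀ p = p ⊟ p₀ via solve (X₀ ∷ A₀ ∷ X ∷ A ∷ x ∷ [])
          second P₀@(inj₁ p₀ , _) P@(inj₂ p , _) = ⊥-elim (absurd P₀ P p₀ p)
          second P₀@(inj₂ p₀ , _) P@(inj₁ p , _) = ⊥-elim (absurd P P₀ p p₀)

          build : ∃ Pred → ∃ λ y → (y ≉ 0ℤ → x k ≈ y) × Generic 94 (λ j → X (k + j) ≈ y + A j)
          build (j₀ , p₀) = X (k + j₀) - A j₀ , first p₀ , weaken (λ j p → second p₀ p) generic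

        y : ℤ → ℤ
        y k = proj₁ (intercept k)

        meet : ∀ k k′ → ∃ λ l → y k + A (- k + l) ≈ y k′ + A (- k′ + l)
        -- The 94 + 94 = 188 classes here are the most excluded anywhere; 256 is the least power of
        -- two above 188.
        meet k k′ = combine (pick (shift (- k) (proj₂ (proj₂ (intercept k))) ⊗ shift (- k′) (proj₂ (proj₂ (intercept k′)))))
          where
          lemma : ∀ k l → k + (- k + l) ≡ l
          lemma = solve-∀
          combine : (∃ λ l → X (k + (- k + l)) ≈ y k + A (- k + l) × X (k′ + (- k′ + l)) ≈ y k′ + A (- k′ + l)) →
            ∃ λ l → y k + A (- k + l) ≈ y k′ + A (- k′ + l)
          combine (l , p , p′) = l , ≈-trans (≈-sym p)
            (subst (λ m → X m ≈ y k′ + A (- k′ + l)) (trans (lemma k′ l) (sym (lemma k l))) p′)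

        -- By `meet`, y k - y k′ ≈ A (l - k′) - A (l - k), so y is well defined and injective modulo
        -- q because column n + 1 is.
        refined-column : GoodColumn x y
        refined-column = record
          { S-cong = λ {k} {k′} k≈k′ → let l , p = meet k k′ in
              cancel {y k} {y k′} {A (- k + l)} {A (- k′ + l)} p (S-cong r₁ (core₁ {k} {k′} {l} k≈k′))
          ; S-inj  = λ {k} {k′} y≈y′ → let l , p = meet k k′ in
              core₂ {k} {k′} {l} (GoodColumn.S-inj (column r₁) (cancel′ {y k} {y k′} {A (- k + l)} {A (- k′ + l)} p y≈y′))
          ; agrees = λ {k} → proj₁ (proj₂ (intercept k)) }
          where
          core₁ : ∀ {k k′ l} → k ≈ k′ → z + (- k + l) ≈ z + (- k′ + l)
          core₁ {k} {k′} {l} p = ≈-sym (p via lemma z k k′ l)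
            where
            lemma : ∀ z k k′ l → z + (- k′ + l) - (z + (- k + l)) ≡ k - k′
            lemma = solve-∀
          core₂ : ∀ {k k′ l} → z + (- k + l) ≈ z + (- k′ + l) → k ≈ k′
          core₂ {k} {k′} {l} p = ≈-sym (p via lemma z k k′ l)
            where
            lemma : ∀ z k k′ l → k′ - k ≡ z + (- k + l) - (z + (- k′ + l))
            lemma = solve-∀
          cancel : ∀ {y y′ a a′} → y + a ≈ y′ + a′ → a ≈ a′ → y ≈ y′
          cancel {y} {y′} {a} {a′} p e = p ⊟ e via solve (y ∷ y′ ∷ a ∷ a′ ∷ [])
          cancel′ : ∀ {y y′ a a′} → y + a ≈ y′ + a′ → y ≈ y′ → a ≈ a′
          cancel′ {y} {y′} {a} {a′} p e = p ⊟ e via solve (y ∷ y′ ∷ a ∷ a′ ∷ [])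

    refinement : ∀ {z} → S n z ≈ 0ℤ → ∃ (GoodColumn (λ k → V n (z + + q * k)))
    refinement Sz≈0 =
      let open Refinement Sz≈0 ; a , b , da≉db = two-shifts in y a b da≉db , refined-column a b da≉db

-- Reflection of the board and refinement of a solution

module Descent (q half N : ℕ) (q-even : + q ≡ + half + + half) .{{_ : ℕ.NonZero q}} (q-large : 256 ℕ.≤ q)
  (N-large : q ℕ.+ q ℕ.+ 8 ℕ.≤ N) where
  open Congruence q
  open Boards q half N q-even

  ≤-combine : ∀ {a b c d x y} → a ℤ.≤ b → c ℤ.≤ d → y - x ≡ (b - a) + (d - c) → x ℤ.≤ y
  ≤-combine a≤b c≤d e = ℤₚ.0≤i-j⇒j≤i (subst (0ℤ ℤ.≤_) (sym e) (ℤₚ.+-mono-≤ (ℤₚ.i≤j⇒0≤j-i a≤b) (ℤₚ.i≤j⇒0≤j-i c≤d)))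

  inRange? : ∀ n → Dec (InRange n)
  inRange? n = (1ℤ ℤ.≤? n) ×-dec (n ℤ.≤? + N)

  module _ {V S : ℤ → ℤ → ℤ} (sol : Solution V S) where
    module Local = Columns q half N q-even q-large sol

    room : ∀ {n} → InRange n → + (q ℕ.+ 4) + n ℤ.≤ + N → Local.Room n
    room {n} (1≤n , _) top = record
      { r₀ = subst InRange (ℤₚ.+-identityˡ n) (offset {0} ℕ.z≤n)
      ; r₁ = offset (near (ℕ.s≤s ℕ.z≤n))
      ; r₂ = subst InRange (ℤₚ.+-assoc 1ℤ 1ℤ n) (offset (near (ℕ.s≤s (ℕ.s≤s ℕ.z≤n))))
      ; r₃ = subst InRange (lemma₃ n) (offset (near (ℕ.s≤s (ℕ.s≤s (ℕ.s≤s ℕ.z≤n)))))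
      ; r₄ = subst InRange (lemma₄ n) (offset (near (ℕ.s≤s (ℕ.s≤s (ℕ.s≤s (ℕ.s≤s ℕ.z≤n))))))
      ; s₀ = offset (ℕₚ.m≤m+n q 4)
      ; s₁ = subst InRange (ℤₚ.+-assoc (+ q) 1ℤ n) (offset (ℕₚ.+-monoʳ-≤ q (ℕ.s≤s ℕ.z≤n)))
      ; s₂ = subst InRange (lemma₅ (+ q) n) (offset (ℕₚ.+-monoʳ-≤ q (ℕ.s≤s (ℕ.s≤s ℕ.z≤n)))) }
      where
      offset : ∀ {c} → c ℕ.≤ q ℕ.+ 4 → InRange (+ c + n)
      offset c≤ = ℤₚ.≤-trans 1≤n (ℤₚ.i≤j+i n (+ _)) , ℤₚ.≤-trans (ℤₚ.+-monoˡ-≤ n (ℤ.+≤+ c≤)) top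
      near : ∀ {c} → c ℕ.≤ 4 → c ℕ.≤ q ℕ.+ 4
      near c≤4 = ℕₚ.≤-trans c≤4 (ℕₚ.m≤n+m 4 q)
      lemma₃ : ∀ n → + 3 + n ≡ 1ℤ + (1ℤ + (1ℤ + n))
      lemma₃ = solve-∀
      lemma₄ : ∀ n → + 4 + n ≡ 1ℤ + (1ℤ + (1ℤ + (1ℤ + n)))
      lemma₄ = solve-∀
      lemma₅ : ∀ q n → q + + 2 + n ≡ q + (1ℤ + (1ℤ + n))
      lemma₅ = solve-∀

  flip : ℤ → ℤ
  flip n = + suc N - n

  flip-flip : ∀ n → flip (flip n) ≡ n
  flip-flip = lemma (+ suc N)
    where
    lemma : ∀ F n → F - (F - n) ≡ n
    lemma = solve-∀

  flip-range : ∀ {n} → InRange n → InRange (flip n)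
  flip-range {n} (1≤n , n≤N) = ≤-combine n≤N (ℤₚ.≤-refl {1ℤ}) (lemma₁ (+ N) n) , ≤-combine 1≤n (ℤₚ.≤-refl {1ℤ}) (lemma₂ (+ N) n)
    where
    lemma₁ : ∀ N n → 1ℤ + N - n - 1ℤ ≡ N - n + (1ℤ - 1ℤ)
    lemma₁ = solve-∀
    lemma₂ : ∀ N n → N - (1ℤ + N - n) ≡ n - 1ℤ + (1ℤ - 1ℤ)
    lemma₂ = solve-∀

  flip-line : ∀ {V j i} → Line V (- j) (j * + suc N + i) → Line (λ n → V (flip n)) j i
  flip-line {V} {j} {i} ℓ = record
    { α = - α
    ; η = α * + suc N + η
    ; nontrivial = λ a≈0 b≈0 → nontrivial (core₁ a≈0) (core₂ (core₁ a≈0) b≈0)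
    ; value = λ {n} r h≉0 → subst₂ (λ m v → V (flip n) m ≈ v) (row≡ n) (h≡ n) (value (flip-range r) (h≉0 ∘ subst (_≈ 0ℤ) (h≡ n)))
    ; deeper = λ {n} r s h≈0 → turn n (deeper (flip-range s) (subst InRange (sym (flip-far n)) (flip-range r))
        (back n (subst (_≈ 0ℤ) (sym (h≡ n)) h≈0)))
    }
    where
    open Line ℓ
    F = + suc N
    core₁ : - α ≈ 0ℤ → α ≈ 0ℤ
    core₁ p = ≈-sym (p via lemma α)
      where
      lemma : ∀ α → 0ℤ - α ≡ - α - 0ℤ
      lemma = solve-∀
    core₂ : α ≈ 0ℤ → α * F + η ≈ 0ℤ → η ≈ 0ℤ
    core₂ a p = p ⊟ scale F a via lemma α F η
      where
      lemma : ∀ α F η → η - 0ℤ ≡ α * F + η - F * α - (0ℤ - F * 0ℤ)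
      lemma = solve-∀
    row≡ : ∀ n → row (flip n) ≡ j * n + i
    row≡ n = lemma j i F n
      where
      lemma : ∀ j i F n → - j * (F - n) + (j * F + i) ≡ j * n + i
      lemma = solve-∀
    h≡ : ∀ n → h (flip n) ≡ - α * n + (α * F + η)
    h≡ n = lemma α η F n
      where
      lemma : ∀ α η F n → α * (F - n) + η ≡ - α * n + (α * F + η)
      lemma = solve-∀
    flip-far : ∀ n → + q + flip (+ q + n) ≡ flip n
    flip-far n = lemma (+ q) F n
      where
      lemma : ∀ q F n → q + (F - (q + n)) ≡ F - n
      lemma = solve-∀
    back : ∀ n → h (flip n) ≈ 0ℤ → h (flip (+ q + n)) ≈ 0ℤ
    back n p = ≈-trans (multiple (- α) (lemma α η F n (+ q))) p
      where
      lemma : ∀ α η F n q → α * (F - (q + n)) + η - (α * (F - n) + η) ≡ - α * q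
      lemma = solve-∀
    turn : ∀ n → (∃ λ κ → (κ ≉ 0ℤ → V (flip (+ q + n)) (row (flip (+ q + n))) ≈ κ) ×
        (κ + α ≉ 0ℤ → V (+ q + flip (+ q + n)) (row (+ q + flip (+ q + n))) ≈ κ + α)) →
      ∃ λ κ → (κ ≉ 0ℤ → V (flip n) (j * n + i) ≈ κ) ×
        (κ + - α ≉ 0ℤ → V (flip (+ q + n)) (j * (+ q + n) + i) ≈ κ + - α)
    -- The reflection swaps the two columns at distance q, so the new κ is the old next digit at the
    -- far column.
    turn n (κ , v , w) = κ + α
      , (λ ne → subst₂ (λ c m → V c m ≈ κ + α) (flip-far n) (trans (cong row (flip-far n)) (row≡ n)) (w ne))
      , λ ne → subst₂ (λ c m → V (flip (+ q + n)) c ≈ m) (row≡ (+ q + n)) (lemma κ α) (v (ne ∘ subst (_≈ 0ℤ) (lemma κ α)))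
      where
      lemma : ∀ κ α → κ ≡ κ + α + - α
      lemma = solve-∀

  flip-solution : ∀ {V S} → Solution V S → Solution (λ n → V (flip n)) (λ n → S (flip n))
  flip-solution sol = record
    { nonzero = λ r → nonzero (flip-range r)
    ; line    = λ j i → flip-line (line (- j) (j * + suc N + i))
    ; column  = λ r → column (flip-range r) }
    where open Solution sol

  module _ {V S : ℤ → ℤ → ℤ} (sol : Solution V S) where
    open Solution sol

    private
      sol′ : Solution (λ n → V (flip n)) (λ n → S (flip n))
      sol′ = flip-solution sol

    -- A column too close to the right edge has enough room on its left.
    room-flipped : ∀ {n m} c → m ≡ + c + n → InRange m → ¬ (+ (q ℕ.+ 4) + n ℤ.≤ + N) → Local.Room sol′ (flip m)
    -- Without room on the right, n ≥ N - q - 3 ≥ q + 5, the last by N ≥ 2 (q + 4).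
    room-flipped {n} c refl r top = room sol′ (flip-range r) (≤-combine (ℤₚ.i<j⇒suc[i]≤j (ℤₚ.≰⇒> top))
        (ℤ.+≤+ (ℕₚ.≤-trans N-large (ℕₚ.m≤m+n N c))) (lemma (+ q) (+ N) n (+ c)))
      where
      lemma : ∀ q N n c → N - (q + + 4 + (1ℤ + N - (c + n))) ≡ (q + + 4 + n - (1ℤ + N)) + (N + c - (q + q + + 8))
      lemma = solve-∀

    aligned : ∀ {n z w t} → InRange n → InRange (sucℤ (sucℤ n)) →
      S n z ≈ 0ℤ → S (sucℤ n) w ≈ 0ℤ → S (sucℤ (sucℤ n)) t ≈ 0ℤ → w + w ≈ z + t
    aligned {n} {z} {w} {t} r r₂ Sz Sw St with (+ (q ℕ.+ 4) + n) ℤ.≤? + N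
    ... | yes top = Local.zeros-aligned sol (room sol r top) Sz Sw St
    ... | no ¬top = ≈-trans (Local.zeros-aligned sol′ (room-flipped {n} 2 (sym (ℤₚ.+-assoc 1ℤ 1ℤ n)) r₂ ¬top)
          (subst (λ m → S m t ≈ 0ℤ) (sym (flip-flip (sucℤ (sucℤ n)))) St)
          (subst (λ m → S m w ≈ 0ℤ) (lemma₁ (+ suc N) n) Sw)
          (subst (λ m → S m z ≈ 0ℤ) (lemma₂ (+ suc N) n) Sz))
        (≈-reflexive (ℤₚ.+-comm t z))
      where
      lemma₁ : ∀ F n → 1ℤ + n ≡ F - (1ℤ + (F - (1ℤ + (1ℤ + n))))
      lemma₁ = solve-∀
      lemma₂ : ∀ F n → n ≡ F - (1ℤ + (1ℤ + (F - (1ℤ + (1ℤ + n)))))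
      lemma₂ = solve-∀

    refine : ∀ n → InRange n → ∀ {z} → S n z ≈ 0ℤ → ∃ λ y → GoodColumn (λ k → V n (z + + q * k)) y
    refine n r {z} Sz with (+ (q ℕ.+ 4) + n) ℤ.≤? + N
    ... | yes top = Local.refinement sol (room sol r top) Sz
    ... | no ¬top = subst (λ m → ∃ (GoodColumn (λ k → V m (z + + q * k)))) (flip-flip n)
          (Local.refinement sol′ (room-flipped {n} 0 (sym (ℤₚ.+-identityˡ n)) r ¬top)
            (subst (λ m → S m z ≈ 0ℤ) (sym (flip-flip n)) Sz))

    1∈ : InRange 1ℤ
    1∈ = ℤ.+≤+ (ℕ.s≤s ℕ.z≤n) , ℤ.+≤+ (ℕₚ.≤-trans (ℕₚ.≤-trans (ℕ.s≤s ℕ.z≤n) (ℕₚ.m≤n+m 8 (q ℕ.+ q))) N-large)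
    2∈ : InRange (+ 2)
    2∈ = ℤ.+≤+ (ℕ.s≤s ℕ.z≤n) , ℤ.+≤+ (ℕₚ.≤-trans (ℕₚ.≤-trans (ℕ.s≤s (ℕ.s≤s ℕ.z≤n)) (ℕₚ.m≤n+m 8 (q ℕ.+ q))) N-large)

    z₁ z₂ slope : ℤ
    z₁ = proj₁ (S-surj (column 1∈) 0ℤ)
    z₂ = proj₁ (S-surj (column 2∈) 0ℤ)
    slope = z₂ - z₁

    zero-row : ℤ → ℤ
    zero-row n = slope * n + (z₁ - slope)

    -- The zeros of two neighbouring columns determine the next one through 2w ≈ z + t, so the
    -- induction carries a pair.
    zero-rows : ∀ a → InRange (+ suc (suc a)) →
      S (+ suc a) (zero-row (+ suc a)) ≈ 0ℤ × S (+ suc (suc a)) (zero-row (+ suc (suc a))) ≈ 0ℤ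
    zero-rows zero _ =
        ≈-trans (GoodColumn.S-cong (column 1∈) (≈-reflexive (lemma₁ z₁ z₂))) (proj₂ (S-surj (column 1∈) 0ℤ))
      , ≈-trans (GoodColumn.S-cong (column 2∈) (≈-reflexive (lemma₂ z₁ z₂))) (proj₂ (S-surj (column 2∈) 0ℤ))
      where
      lemma₁ : ∀ z₁ z₂ → (z₂ - z₁) * 1ℤ + (z₁ - (z₂ - z₁)) ≡ z₁
      lemma₁ = solve-∀
      lemma₂ : ∀ z₁ z₂ → (z₂ - z₁) * + 2 + (z₁ - (z₂ - z₁)) ≡ z₂
      lemma₂ = solve-∀
    zero-rows (suc a) r@(_ , below) =
      let n              = + suc a
          r₀             = ℤ.+≤+ (ℕ.s≤s ℕ.z≤n) , ℤₚ.≤-trans (ℤₚ.i≤j+i n (+ 2)) below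
          r₁             = ℤ.+≤+ (ℕ.s≤s ℕ.z≤n) , ℤₚ.≤-trans (ℤₚ.i≤j+i (sucℤ n) (+ 1)) below
          p₀ , p₁        = zero-rows a r₁
          t , St         = S-surj (column r) 0ℤ
      in p₁ , ≈-trans (GoodColumn.S-cong (column r) (aligned {n} r₀ r p₀ p₁ St via lemma slope (z₁ - slope) n t)) St
      where
      lemma : ∀ s i n t → s * (1ℤ + (1ℤ + n)) + i - t ≡ (s * (1ℤ + n) + i) + (s * (1ℤ + n) + i) - (s * n + i + t)
      lemma = solve-∀

    zero-row-vanishes : ∀ n → InRange n → S n (zero-row n) ≈ 0ℤ
    zero-row-vanishes (+ suc zero)    r = proj₁ (zero-rows 0 2∈)
    zero-row-vanishes (+ suc (suc a)) r = proj₂ (zero-rows a r)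
    zero-row-vanishes (+ 0) (ℤ.+≤+ () , _)
    zero-row-vanishes -[1+ _ ] (() , _)

    -- S is indexed by all integers, but `refine` wants a range proof: off the board the identity is
    -- a placeholder. The decision is an argument so that `good` can match on it.
    S′ : ∀ n → Dec (InRange n) → ℤ → ℤ
    S′ n (yes r) = proj₁ (refine n r (zero-row-vanishes n r))
    S′ n (no  _) = λ m → m

    refine-solution : Solution (λ n k → V n (zero-row n + + q * k)) (λ n → S′ n (inRange? n))
    refine-solution = record
      { nonzero = nonzero
      -- A line of slope j on the refined board is one of slope `slope` + q j on the old board, with
      -- the same α and η.
      ; line    = λ j i → transport j i (line (slope + + q * j) (z₁ - slope + + q * i))
      ; column  = λ {n} r → good n (inRange? n) r }
      where
      good : ∀ n (d : Dec (InRange n)) → InRange n → GoodColumn (λ k → V n (zero-row n + + q * k)) (S′ n d)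
      good n (yes r) _ = proj₂ (refine n r (zero-row-vanishes n r))
      good n (no ¬r) r = contradiction r ¬r
      transport : ∀ j i → Line V (slope + + q * j) (z₁ - slope + + q * i) →
        Line (λ n k → V n (zero-row n + + q * k)) j i
      transport j i ℓ = record
        { α = α ; η = η ; nontrivial = nontrivial
        ; value = λ {n} r h≉0 → subst (λ m → V n m ≈ h n) (row≡ n) (value r h≉0)
        ; deeper = λ {n} r s h≈0 → let κ , v , w = deeper r s h≈0 in κ
            , (λ ne → subst (λ m → V n m ≈ κ) (row≡ n) (v ne))
            , λ ne → subst (λ m → V (+ q + n) m ≈ κ + α) (row≡ (+ q + n)) (w ne) }
        where
        open Line ℓ
        row≡ : ∀ n → row n ≡ zero-row n + + q * (j * n + i)
        row≡ n = lemma slope (z₁ - slope) (+ q) j i n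
          where
          lemma : ∀ s i₀ q j i n → (s + q * j) * n + (i₀ + q * i) ≡ s * n + i₀ + q * (j * n + i)
          lemma = solve-∀

  -- Periods and infinite descent

  -- At a row m such that S n is nonzero at both m and m + p, periodicity equates two values of a
  -- permutation.
  period-divisible : ∀ {V S} → Solution V S → ∀ {n} → InRange n → ∀ p → (∀ m → V n (m + p) ≈ V n m) → p ≈ 0ℤ
  period-divisible {V} {S} sol {n} r p periodic with generic-exists (ℕₚ.≤-trans (ℕₚ.m≤m+n 3 253) q-large)
    (avoid-value (column r) 0ℤ ⊗ shift p (avoid-value (column r) 0ℤ))
    where open Solution sol
  ... | m , s≉0 , s′≉0 = S-inj (≈-trans (≈-sym (agrees s′≉0)) (≈-trans (≈-reflexive (cong (V n) (ℤₚ.+-comm p m)))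
        (≈-trans (periodic m) (agrees s≉0)))) via lemma p m
    where
    open GoodColumn (Solution.column sol r)
    lemma : ∀ p m → p - 0ℤ ≡ p + m - m
    lemma = solve-∀

  aperiodic : ∀ p → 1 ℕ.≤ p → ∀ {V S} → Solution V S → ¬ (∀ m → V 1ℤ (m + + p) ≈ V 1ℤ m)
  aperiodic = <-rec _ λ p rec 1≤p {V} {S} sol periodic → descend p rec 1≤p sol periodic
    (∣⇒∣ᵤ (subst (+ q ∣_) (ℤₚ.+-identityʳ (+ p)) (_≈_.difference (period-divisible sol (1∈ sol) (+ p) periodic))))
    where
    descend : ∀ p → (∀ {p′} → p′ ℕ.< p → 1 ℕ.≤ p′ → ∀ {V S} → Solution V S → ¬ (∀ m → V 1ℤ (m + + p′) ≈ V 1ℤ m)) →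
      1 ℕ.≤ p → ∀ {V S} → Solution V S → (∀ m → V 1ℤ (m + + p) ≈ V 1ℤ m) → q ℕ∣.∣ p → ⊥
    descend p rec 1≤p {V} sol periodic (ℕ∣.divides zero refl) = contradiction 1≤p λ ()
    descend p rec 1≤p {V} sol periodic (ℕ∣.divides p′@(suc _) refl) =
      rec (ℕₚ.m<m*n p′ q (ℕₚ.≤-trans (ℕ.s≤s (ℕ.s≤s ℕ.z≤n)) q-large)) (ℕ.s≤s ℕ.z≤n) (refine-solution sol)
        λ m → subst (λ c → V 1ℤ c ≈ V 1ℤ (zero-row sol 1ℤ + + q * m)) (step m) (periodic (zero-row sol 1ℤ + + q * m))
      where
      step : ∀ m → zero-row sol 1ℤ + + q * m + + (p′ ℕ.* q) ≡ zero-row sol 1ℤ + + q * (m + + p′)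
      step m = trans (cong (λ c → zero-row sol 1ℤ + + q * m + c) (ℤₚ.pos-* p′ q)) (lemma (zero-row sol 1ℤ) (+ q) m (+ p′))
        where
        lemma : ∀ z q m p → z + q * m + p * q ≡ z + q * (m + p)
        lemma = solve-∀

-- The last nonzero digit

module LastDigit (q : ℕ) .{{_ : ℕ.NonZero q}} (1<q : 1 ℕ.< q) where
  open Congruence q

  quotient-positive : ∀ n → 1 ℕ.≤ n → n ℕ.% q ≡ 0 → 1 ℕ.≤ n ℕ./ q
  quotient-positive n 1≤n r≡0 with n ℕ./ q | ℕ/.m≡m%n+[m/n]*n n q
  ... | zero  | e = contradiction (subst (1 ℕ.≤_) (trans e (cong (ℕ._+ 0) r≡0)) 1≤n) λ ()
  ... | suc _ | _ = ℕ.s≤s ℕ.z≤n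

  -- The fuel of `f` equals its argument, so removing a factor q changes the fuel too. Each division
  -- makes n ≥ 1 smaller but keeps it positive, so any fuel of at least n gives the same digit.
  fuel-irrelevant : ∀ e g n → 1 ℕ.≤ n → n ℕ.≤ e → n ℕ.≤ g → lastDigitℕ e q n ≡ lastDigitℕ g q n
  fuel-irrelevant zero    _       _ 1≤n n≤e _   = contradiction (ℕₚ.≤-trans 1≤n n≤e) λ ()
  fuel-irrelevant (suc e) zero    _ 1≤n _   n≤g = contradiction (ℕₚ.≤-trans 1≤n n≤g) λ ()
  fuel-irrelevant (suc e) (suc g) n 1≤n n≤e n≤g with n ℕ.% q in r≡
  ... | zero  = fuel-irrelevant e g (n ℕ./ q) (quotient-positive n 1≤n r≡)
      (ℕₚ.≤-pred (ℕₚ.<-≤-trans smaller n≤e)) (ℕₚ.≤-pred (ℕₚ.<-≤-trans smaller n≤g))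
    where
    smaller : n ℕ./ q ℕ.< n
    smaller = ℕ/.m/n<m n q {{ℕ.>-nonZero 1≤n}} 1<q
  ... | suc _ = refl

  digit : ℕ → ℕ
  digit n = lastDigitℕ n q n

  digit-residue : ∀ n → ¬ q ℕ∣.∣ n → digit n ≡ n ℕ.% q
  digit-residue zero    _ = refl
  digit-residue (suc n) ∤ with suc n ℕ.% q in r≡
  ... | zero  = contradiction (ℕ∣.m%n≡0⇒n∣m (suc n) q r≡) ∤
  ... | suc _ = refl

  digit-shift : ∀ n → 1 ℕ.≤ n → digit (q ℕ.* n) ≡ digit n
  digit-shift n 1≤n with q ℕ.* n in e
  ... | zero  = contradiction (ℕₚ.≤-trans (ℕₚ.*-mono-≤ (ℕₚ.<⇒≤ 1<q) 1≤n) (ℕₚ.≤-reflexive e)) λ ()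
  ... | suc k with suc k ℕ.% q in r≡
  ...   | zero  = trans (cong (lastDigitℕ k q) quotient≡n) (fuel-irrelevant k n n 1≤n
            (ℕₚ.≤-pred (ℕₚ.<-≤-trans (ℕₚ.m<m*n n q {{ℕ.>-nonZero 1≤n}} 1<q) (ℕₚ.≤-reflexive (trans (ℕₚ.*-comm n q) e)))) ℕₚ.≤-refl)
    where
    quotient≡n : suc k ℕ./ q ≡ n
    quotient≡n = trans (cong (ℕ._/ q) (sym (trans (ℕₚ.*-comm n q) e))) (ℕ/.m*n/n≡m n q)
  ...   | suc _ = contradiction (trans (sym r≡) (trans (cong (ℕ._% q) (sym (trans (ℕₚ.*-comm n q) e))) (ℕ/.m*n%n≡0 n q))) λ ()

  f-pos : ∀ n → 1 ℕ.≤ n → f q (+ n) ≡ red q (+ digit n)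
  f-pos (suc n) _ = refl

  f-neg : ∀ n → 1 ℕ.≤ n → f q (- + n) ≡ red q (- + digit n)
  f-neg (suc n) _ = refl

  f-shift : ∀ x → f q (+ q * x) ≡ f q x
  f-shift (+ zero)  = cong (f q) (ℤₚ.*-zeroʳ (+ q))
  f-shift (+ suc n) = trans (cong (f q) (sym (ℤₚ.pos-* q (suc n)))) (trans (f-pos (q ℕ.* suc n) (positive n))
      (cong (λ d → red q (+ d)) (digit-shift (suc n) (ℕ.s≤s ℕ.z≤n))))
    where
    positive : ∀ n → 1 ℕ.≤ q ℕ.* suc n
    positive n = ℕₚ.*-mono-≤ (ℕₚ.<⇒≤ 1<q) (ℕ.s≤s (ℕ.z≤n {n}))
  f-shift -[1+ n ]  = trans (cong (f q) (trans (sym (ℤₚ.neg-distribʳ-* (+ q) (+ suc n))) (cong -_ (sym (ℤₚ.pos-* q (suc n))))))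
      (trans (f-neg (q ℕ.* suc n) (ℕₚ.*-mono-≤ (ℕₚ.<⇒≤ 1<q) (ℕ.s≤s (ℕ.z≤n {n}))))
        (cong (λ d → red q (- + d)) (digit-shift (suc n) (ℕ.s≤s ℕ.z≤n))))

  fᶻ : ℤ → ℤ
  fᶻ x = + toℕ (f q x)

  digit-≈ : ∀ n → ¬ q ℕ∣.∣ n → + digit n ≈ + n
  digit-≈ n ∤ = ≈-trans (≈-reflexive (cong +_ (digit-residue n ∤))) (≈-sym (multiple (+ n /ℕ q)
      (trans (cong (_- + (n ℕ.% q)) (a≡a%ℕn+[a/ℕn]*n (+ n) q)) (lemma (+ (n ℕ.% q)) ((+ n /ℕ q) * + q)))))
    where
    lemma : ∀ r m → r + m - r ≡ m
    lemma = solve-∀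

  nondivisible : ∀ {x} → x ≉ 0ℤ → ¬ q ℕ∣.∣ ∣ x ∣
  nondivisible {x} x≉0 d = x≉0 (mod (subst (+ q ∣_) (sym (ℤₚ.+-identityʳ x)) (∣ᵤ⇒∣ d)))

  f-≈ : ∀ x → x ≉ 0ℤ → fᶻ x ≈ x
  f-≈ (+ zero)  x≉0 = contradiction ≈-refl x≉0
  f-≈ (+ suc n) x≉0 = ≈-trans (red-≈ _) (digit-≈ (suc n) (nondivisible x≉0))
  f-≈ -[1+ n ]  x≉0 = ≈-trans (red-≈ _) (negate (digit-≈ (suc n) (nondivisible x≉0)))
    where
    negate : ∀ {a b} → a ≈ b → - a ≈ - b
    negate {a} {b} p = ≈-sym p via lemma a b
      where
      lemma : ∀ a b → - a - - b ≡ b - a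
      lemma = solve-∀

  f-zero : fᶻ 0ℤ ≈ 1ℤ
  f-zero = red-≈ 1ℤ

  1≉0 : 1ℤ ≉ 0ℤ
  1≉0 (mod d) = ℕ∣.>⇒∤ 1<q (∣⇒∣ᵤ d)

  multiple-of-q : ∀ {x} → x ≈ 0ℤ → ∃ λ y → x ≡ + q * y
  multiple-of-q {x} (mod (divides y e)) = y , trans (sym (ℤₚ.+-identityʳ x)) (trans e (ℤₚ.*-comm y (+ q)))

  -- A common factor q of a and b leaves the last digit unchanged, so it is divided out. This
  -- provides the field `nontrivial` of a line.
  normalise : ∀ fuel a b → ∣ a ∣ ℕ.+ ∣ b ∣ ℕ.≤ fuel →
    ∃ λ a′ → ∃ λ b′ → (a′ ≈ 0ℤ → b′ ≉ 0ℤ) × (∀ x → fᶻ (a * x + b) ≈ fᶻ (a′ * x + b′))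
  -- Here a = b = 0, and the convention f 0 = 1 is matched by the constant 1.
  normalise zero a b le = 0ℤ , 1ℤ , (λ _ → 1≉0) , λ x →
    ≈-trans (≈-reflexive (cong fᶻ (vanish x))) (≈-trans f-zero (≈-sym (f-≈ 1ℤ 1≉0)))
    where
    sum≡0 = ℕₚ.n≤0⇒n≡0 le
    vanish : ∀ x → a * x + b ≡ 0ℤ
    vanish x = cong₂ (λ c d → c * x + d) {a} {0ℤ} {b} {0ℤ} (ℤₚ.∣i∣≡0⇒i≡0 (ℕₚ.m+n≡0⇒m≡0 ∣ a ∣ sum≡0)) (ℤₚ.∣i∣≡0⇒i≡0 (ℕₚ.m+n≡0⇒n≡0 ∣ a ∣ sum≡0))
  normalise (suc fuel) a b le with a ≈? 0ℤ | b ≈? 0ℤ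
  ... | no a≉0  | _       = a , b , (λ a≈0 → contradiction a≈0 a≉0) , λ _ → ≈-refl
  ... | yes _   | no b≉0  = a , b , (λ _ → b≉0) , λ _ → ≈-refl
  ... | yes a≈0 | yes b≈0 = reduce (multiple-of-q a≈0) (multiple-of-q b≈0)
    where
    smaller : ∀ m → m ℕ.* q ℕ.≤ suc fuel → m ℕ.≤ fuel
    smaller zero    _  = ℕ.z≤n
    smaller (suc m) le = ℕₚ.≤-pred (ℕₚ.<-≤-trans (ℕₚ.m<m*n (suc m) q 1<q) le)
    reduce : (∃ λ y → a ≡ + q * y) → (∃ λ y → b ≡ + q * y) →
      ∃ λ a′ → ∃ λ b′ → (a′ ≈ 0ℤ → b′ ≉ 0ℤ) × (∀ x → fᶻ (a * x + b) ≈ fᶻ (a′ * x + b′))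
    reduce (a₁ , refl) (b₁ , refl) =
      let a′ , b′ , nontrivial , e = normalise fuel a₁ b₁ (smaller (∣ a₁ ∣ ℕ.+ ∣ b₁ ∣) (ℕₚ.≤-trans (ℕₚ.≤-reflexive size) le))
      in a′ , b′ , nontrivial , λ x → ≈-trans (≈-reflexive (trans (cong fᶻ (lemma (+ q) a₁ b₁ x)) (cong (λ r → + toℕ r) (f-shift (a₁ * x + b₁))))) (e x)
      where
      lemma : ∀ q a b x → q * a * x + q * b ≡ q * (a * x + b)
      lemma = solve-∀
      size : (∣ a₁ ∣ ℕ.+ ∣ b₁ ∣) ℕ.* q ≡ ∣ + q * a₁ ∣ ℕ.+ ∣ + q * b₁ ∣
      size = trans (ℕₚ.*-comm _ q) (trans (ℕₚ.*-distribˡ-+ q ∣ a₁ ∣ ∣ b₁ ∣) (sym (cong₂ ℕ._+_ (ℤₚ.abs-* (+ q) a₁) (ℤₚ.abs-* (+ q) b₁))))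

odd-cancel : ∀ {c} → OddInt c → ∀ s x → + (2 ℕ.^ s) ∣ c * x → + (2 ℕ.^ s) ∣ x
odd-cancel         _          zero    x _             = divides x (sym (ℤₚ.*-identityʳ x))
odd-cancel {c} odd@(k , c≡) (suc s) x (divides m e) = double (odd-cancel odd s y (divides m (ℤₚ.*-cancelʳ-≡ (c * y) (m * p) (+ 2) c*y≡)))
  where
  p = + (2 ℕ.^ s)
  -- This is x / 2: with c = 2k + 1 and c x = 2 m p, one has x = c x - 2 k x.
  y = m * p - k * x
  2p : + (2 ℕ.^ suc s) ≡ + 2 * p
  2p = ℤₚ.pos-* 2 (2 ℕ.^ s)
  x≡ : y * + 2 ≡ x
  x≡ = trans (lemma₁ m p k x) (trans (cong (_- + 2 * k * x) (sym (trans e (cong (m *_) 2p)))) (trans (cong (λ c → c * x - + 2 * k * x) c≡) (lemma₂ k x)))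
    where
    lemma₁ : ∀ m p k x → (m * p - k * x) * + 2 ≡ m * (+ 2 * p) - + 2 * k * x
    lemma₁ = solve-∀
    lemma₂ : ∀ k x → (+ 2 * k + + 1) * x - + 2 * k * x ≡ x
    lemma₂ = solve-∀
  c*y≡ : c * y * + 2 ≡ m * p * + 2
  c*y≡ = trans (ℤₚ.*-assoc c y (+ 2)) (trans (cong (c *_) x≡) (trans e (trans (cong (m *_) 2p) (lemma m p))))
    where
    lemma : ∀ m p → m * (+ 2 * p) ≡ m * p * + 2
    lemma = solve-∀
  double : p ∣ y → + (2 ℕ.^ suc s) ∣ x
  double (divides n y≡) = divides n (trans (sym x≡) (trans (cong (_* + 2) y≡) (trans (lemma n p) (cong (n *_) (sym 2p)))))
    where
    lemma : ∀ n p → n * p * + 2 ≡ n * (+ 2 * p)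
    lemma = solve-∀

-- From Sudoku boards to solutions modulo q

module Translation (s : ℕ) (large : 8 ℕ.≤ suc s) where

  q half N : ℕ
  q    = qOf (suc s)
  half = 2 ℕ.^ s
  N    = NOf (suc s)

  instance
    q-nonZero : ℕ.NonZero q
    q-nonZero = qOf-nonZero (suc s)

  q-large : 256 ℕ.≤ q
  q-large = ℕₚ.^-monoʳ-≤ 2 large

  q-even : + q ≡ + half + + half
  q-even = cong (λ x → + (half ℕ.+ x)) (ℕₚ.+-identityʳ half)

  1<q : 1 ℕ.< q
  1<q = ℕₚ.≤-trans (ℕₚ.m≤m+n 2 254) q-large

  N-large : q ℕ.+ q ℕ.+ 8 ℕ.≤ N
  N-large = ℕₚ.≤-trans (ℕₚ.+-monoʳ-≤ (q ℕ.+ q) (ℕₚ.≤-trans (ℕₚ.m≤m+n 8 248) q-large))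
    (ℕₚ.≤-trans (ℕₚ.≤-reflexive three) (ℕₚ.*-monoˡ-≤ q (ℕₚ.≤-trans (ℕₚ.m≤m+n 3 253) q-large)))
    where
    three : q ℕ.+ q ℕ.+ q ≡ 3 ℕ.* q
    three = trans (ℕₚ.+-assoc q q q) (cong (λ x → q ℕ.+ (q ℕ.+ x)) (sym (ℕₚ.+-identityʳ q)))

  open Congruence q
  open Boards q half N q-even
  open LastDigit q 1<q
  open Descent q half N q-even q-large N-large using (inRange?; aperiodic)

  inRange-elim : ∀ (P : ℤ → Set) → (∀ a → 1 ℕ.≤ a → a ℕ.≤ N → P (+ a)) → ∀ {n} → InRange n → P n
  inRange-elim P h (ℤ.+≤+ 1≤a , ℤ.+≤+ a≤N) = h _ 1≤a a≤N

  cancel-odd : ∀ {c x} → OddInt c → c * x ≈ 0ℤ → x ≈ 0ℤ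
  cancel-odd {c} {x} odd (mod d) = mod (subst (+ q ∣_) (sym (ℤₚ.+-identityʳ x))
    (odd-cancel odd (suc s) x (subst (+ q ∣_) (ℤₚ.+-identityʳ (c * x)) d)))

  module _ (F : Board (suc s)) (sudoku : SudokuSolution (suc s) F) (columns : GoodColumns (suc s) F) where

    V : ℤ → ℤ → ℤ
    V n m = + toℕ (F ∣ n ∣ m)

    S-at : ∀ n → Dec (InRange n) → ℤ → ℤ
    S-at (+ a)    (yes (ℤ.+≤+ 1≤a , ℤ.+≤+ a≤N)) m = + toℕ (proj₁ (columns a 1≤a a≤N) ⟨$⟩ʳ red q m)
    S-at _        _                             m = m

    column : ∀ n (d : Dec (InRange n)) → InRange n → GoodColumn (V n) (S-at n d)
    column n     (no n∉) n∈ = contradiction n∈ n∉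
    column (+ a) (yes (ℤ.+≤+ 1≤a , ℤ.+≤+ a≤N)) _ = record
      { S-cong = λ {m} {m′} e → ≈-reflexive (cong (λ r → + toℕ (σ ⟨$⟩ʳ r)) (residue-injective _ _
          (≈-trans (red-≈ m) (≈-trans e (≈-sym (red-≈ m′))))))
      ; S-inj = λ {m} {m′} e → ≈-trans (≈-sym (red-≈ m)) (≈-trans (≈-reflexive (cong (+_ ∘ toℕ)
          (Injection.injective (↔⇒↣ σ) (residue-injective _ _ e)))) (red-≈ m′))
      ; agrees = λ {m} s≉0 → ≈-reflexive (cong (+_ ∘ toℕ) (agree m
          λ e → s≉0 (≈-trans (≈-reflexive (cong (+_ ∘ toℕ) e)) (red-≈ 0ℤ)))) }
      where
      σ     = proj₁ (columns a 1≤a a≤N)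
      agree = proj₂ (columns a 1≤a a≤N)

    line : ∀ j i → Line V j i
    line j i with proj₂ sudoku i j
    ... | a₀ , b₀ , c , odd , values with normalise (∣ a₀ ∣ ℕ.+ ∣ b₀ ∣) a₀ b₀ ℕₚ.≤-refl
    ...   | a , b , nontrivial , same = record
      { α = c * a
      ; η = c * b
      ; nontrivial = λ ca≈0 cb≈0 → nontrivial (cancel-odd odd ca≈0) (cancel-odd odd cb≈0)
      ; value = λ {n} r h≉0 → ≈-trans (formula r) (≈-trans (scale c (f-≈ (a * n + b) (inner≉0 n h≉0))) (outer n))
      -- As c is odd, h ≈ 0 makes a n + b a multiple q y, and then a (q + n) + b = q (y + a). The
      -- digit ignores the factor q, so κ = c y, and at distance q it grows by c a = α.
      ; deeper = λ {n} r r′ h≈0 →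
          let y , e = multiple-of-q (cancel-odd odd (≈-trans (outer n) h≈0)) in c * y
            , (λ κ≉0 → ≈-trans (formula r) (scale c (quotient (a * n + b) y e (κ≉0 ∘ scale-0))))
            , λ κ≉0 → ≈-trans (formula r′) (≈-trans
                (scale c (quotient (a * (+ q + n) + b) (y + a) (next n y e) λ z → κ≉0 (≈-trans (≈-sym (distrib y)) (scale-0 z))))
                (distrib y)) }
      where
      formula : ∀ {n} → InRange n → V n (j * n + i) ≈ c * fᶻ (a * n + b)
      formula = inRange-elim (λ n → V n (j * n + i) ≈ c * fᶻ (a * n + b)) λ n 1≤n n≤N →
        ≈-trans (≈-reflexive (cong (+_ ∘ toℕ) (values n 1≤n n≤N)))
          (≈-trans (red-≈ (c * fᶻ (a₀ * + n + b₀))) (scale c (same (+ n))))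
      outer : ∀ n → c * (a * n + b) ≈ c * a * n + c * b
      outer n = ≈-reflexive (lemma c a n b)
        where
        lemma : ∀ c a n b → c * (a * n + b) ≡ c * a * n + c * b
        lemma = solve-∀
      scale-0 : ∀ {x} → x ≈ 0ℤ → c * x ≈ 0ℤ
      scale-0 {x} p = ≈-trans (scale c p) (≈-reflexive (ℤₚ.*-zeroʳ c))
      inner≉0 : ∀ n → c * a * n + c * b ≉ 0ℤ → a * n + b ≉ 0ℤ
      inner≉0 n h≉0 z = h≉0 (≈-trans (≈-sym (outer n)) (scale-0 z))
      distrib : ∀ y → c * (y + a) ≈ c * y + c * a
      distrib y = ≈-reflexive (ℤₚ.*-distribˡ-+ c y a)
      quotient : ∀ x y → x ≡ + q * y → y ≉ 0ℤ → fᶻ x ≈ y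
      quotient x y refl y≉0 = ≈-trans (≈-reflexive (cong (+_ ∘ toℕ) (f-shift y))) (f-≈ y y≉0)
      next : ∀ n y → a * n + b ≡ + q * y → a * (+ q + n) + b ≡ + q * (y + a)
      next n y e = trans (lemma₁ a (+ q) n b) (trans (cong (λ x → x + + q * a) e) (sym (ℤₚ.*-distribˡ-+ (+ q) y a)))
        where
        lemma₁ : ∀ a q n b → a * (q + n) + b ≡ a * n + b + q * a
        lemma₁ = solve-∀

    solution : Solution V (λ n → S-at n (inRange? n))
    solution = record
      { nonzero = λ {n} {m} → inRange-elim (λ n → V n m ≉ 0ℤ) λ a 1≤a a≤N z →
          proj₁ sudoku a m 1≤a a≤N (residue-injective _ _ (≈-trans z (≈-sym (red-≈ 0ℤ))))
      ; line    = line
      ; column  = λ {n} n∈ → column n (inRange? n) n∈ }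

    non-periodic : NonPeriodic (suc s) F
    non-periodic periodic with periodic 1 (ℕ.s≤s ℕ.z≤n) (ℕₚ.≤-trans (ℕₚ.≤-trans (ℕ.s≤s ℕ.z≤n) (ℕₚ.m≤n+m 8 (q ℕ.+ q))) N-large)
    ... | p , 1≤p , e = aperiodic p 1≤p solution λ m → ≈-reflexive (cong (+_ ∘ toℕ) (e m))

theorem7p4 : Σ ℕ λ S₀ → ∀ (s₀ : ℕ) → S₀ ≤ s₀ → ∀ (F : Board s₀) →
    SudokuSolution s₀ F → GoodColumns s₀ F → NonPeriodic s₀ F
theorem7p4 = 8 , λ { (suc s) large F sudoku columns → Translation.non-periodic s large F sudoku columns }
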